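{- Let $k\ge 0$ be an integer. A function $u=\sum_{n=0}^\infty c_nf_n\in C_0(O,\overline{K}_c)$ belongs to $C_0^{k+1}(O,\overline{K}_c)$ if and only if $$q^{nq^k}|c_n|\to 0\quad\text{for } n\to\infty .$$ In this case $$\sup_{t\in O}|\mathfrak D^ku(t)|=\sup_{n\ge k}q^{(n-k)q^k}|c_n|.$$
   Context: Let $\mathbf F_q$ be the finite field with $q=p^\gamma$ elements ($p$ prime, $\gamma\ge 1$), and let $K=\mathbf F_q((x))$ with absolute value $|z|=q^{ -n}$ for $z=\sum_{i=n}^\infty\zeta_i x^i$, $\zeta_i\in\mathbf F_q$, $\zeta_n\neq 0$. Let $O=\{z\in K:|z|\le1\}$ and let $\overline{K}_c$ be the completion of an algebraic closure of $K$, with the extended absolute value. A function $u:O\to\overline{K}_c$ is $\mathbf F_q$-linear if $u(t_1+t_2)=u(t_1)+u(t_2)$ and $u(\alpha t)=\alpha u(t)$ for all $t,t_1,t_2\in O$, $\alpha\in\mathbf F_q$. $C_0(O,\overline{K}_c)$ is the Banach space of all continuous $\mathbf F_q$-linear functions $O\to\overline{K}_c$ with the supremum norm. Put $[i]=x^{q^i}-x$, $D_0=1$, $D_i=[i]\,[i-1]^q\cdots[1]^{q^{i-1}}$ for $i\ge1$. The normalized Carlitz polynomials are $f_i(t)=D_i^{ -1}e_i(t)$, $i\ge 0$, where $e_0(t)=t$ and $e_i(t)=\prod_{m\in\mathbf F_q[x],\,\deg m<i}(t-m)$ for $i\ge1$ (the product includes $m=0$). It is known that every $u\in C_0(O,\overline{K}_c)$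 has a unique uniformly convergent expansion $u=\sum_{n\ge0}c_nf_n$ with $c_n\in\overline{K}_c$, $c_n\to0$, and $\|u\|=\sup_n|c_n|$; the $c_n$ in the claim are these coefficients. The difference operators are $\Delta^{(0)}=\mathrm{id}$, $(\Delta^{(n)}u)(t)=(\Delta^{(n-1)}u)(xt)-x^{q^{n-1}}(\Delta^{(n-1)}u)(t)$ for $n\ge1$. For $u\in C_0(O,\overline{K}_c)$ put $\mathfrak D^ku(t)=t^{ -q^k}(\Delta^{(k)}u)(t)$, $t\in O\setminus\{0\}$. One says $u\in C_0^{k+1}(O,\overline{K}_c)$ if $u\in C_0(O,\overline{K}_c)$ and $\mathfrak D^ku$ can be extended to a continuous function on $O$ (the extension is again denoted $\mathfrak D^ku$). -}

module Defs where

open import Level using (0ℓ)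
open import Algebra.Bundles using (CommutativeRing; Semiring)
open import Algebra.Bundles.Raw using (RawRing)
open import Algebra.Morphism.Structures using (IsRingHomomorphism)
import Algebra.Construct.NaturalChoice.Max as Max
import Algebra.Definitions.RawSemiring as RawSemiringDefs
import Algebra.Properties.Ring as RingProperties
import Algebra.Properties.AbelianGroup as AbelianGroupProperties
open import Data.Empty using (⊥-elim)
open import Data.Fin.Base using (Fin; toℕ; finToFun)
open import Data.Integer.Base as ℤ using (ℤ; +_; -[1+_]; 0ℤ; 1ℤ)
open import Data.Nat.Base as ℕ using (ℕ; zero; suc; _∸_)
open import Data.Product using (Σ-syntax; ∃-syntax; _×_; _,_; proj₁; proj₂)
open import Data.Sum.Base using (_⊎_; inj₁; inj₂)
open import Data.Vec.Functional using (Vector)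
open import Function.Bundles using (Inverse)
open import Relation.Binary using (Rel; IsDecTotalOrder; DecTotalOrder)
import Relation.Binary.Construct.NonStrictToStrict as NonStrictToStrict
open import Relation.Binary.PropositionalEquality using (setoid)
open import Relation.Nullary using (¬_; yes; no)
open import Relation.Unary using (Pred; _∈_)

-- 0# ⁻¹ is left unspecified.
record Field : Set₁ where
  infix 9 _⁻¹
  field
    commutativeRing : CommutativeRing 0ℓ 0ℓ
  open CommutativeRing commutativeRing public
  field
    _⁻¹       : Carrier → Carrier
    ⁻¹-cong   : ∀ {a b} → a ≈ b → a ⁻¹ ≈ b ⁻¹
    0≉1       : ¬ (0# ≈ 1#)
    ⁻¹-inverse : ∀ a → ¬ (a ≈ 0#) → a * a ⁻¹ ≈ 1#
  open RawSemiringDefs (Semiring.rawSemiring semiring) public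
    using (_^_; sum; product) renaming (_×_ to _·_)

-- Any two complete ordered fields are isomorphic, so quantifying over this
-- record is quantifying over presentations of the real numbers.
record CompleteOrderedField : Set₁ where
  infix 4 _≤_
  field
    𝔽 : Field
  open Field 𝔽 public
  field
    _≤_             : Rel Carrier 0ℓ
    isDecTotalOrder : IsDecTotalOrder _≈_ _≤_
    +-monoʳ-≤       : ∀ a {b c} → b ≤ c → a + b ≤ a + c
    *-nonneg        : ∀ {a b} → 0# ≤ a → 0# ≤ b → 0# ≤ a * b

  decTotalOrder : DecTotalOrder 0ℓ 0ℓ 0ℓ
  decTotalOrder = record { isDecTotalOrder = isDecTotalOrder }

  open NonStrictToStrict _≈_ _≤_ public using (_<_)
  open Max (DecTotalOrder.totalOrder decTotalOrder) public using (_⊔_; ⊔-lub)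

  IsUpperBound : {I : Set} → (I → Carrier) → Carrier → Set
  IsUpperBound {I} f b = ∀ (i : I) → f i ≤ b

  -- Classically equivalent to being the least upper bound. Constructively
  -- stronger: together with decidability of ≤, completeness in this form
  -- entails excluded middle, so the reals below are the classical ones.
  IsSup : {I : Set} → (I → Carrier) → Carrier → Set
  IsSup {I} f s = IsUpperBound f s × (∀ y → y < s → ∃[ i ] y < f i)

  -- A subset P is the family proj₁ : Σ Carrier P → Carrier.
  field
    complete : {I : Set} (f : I → Carrier) → I →
               (∃[ b ] IsUpperBound f b) → ∃[ s ] IsSup f s

  TendsToZero : (ℕ → Carrier) → Set
  TendsToZero a =
    ∀ ε → 0# < ε → ∃[ N ] ∀ n → N ℕ.≤ n → (- ε < a n) × (a n < ε)

  fromℕ : ℕ → Carrier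
  fromℕ n = n · 1#

  infixr 8 _^ℤ_
  _^ℤ_ : Carrier → ℤ → Carrier
  a ^ℤ (+ n)     = a ^ n
  a ^ℤ -[1+ n ] = (a ⁻¹) ^ suc n

  open DecTotalOrder decTotalOrder public using ()
    renaming (trans to ≤-trans; total to ≤-total; ≤-respˡ-≈ to ≤-respˡ;
              ≤-respʳ-≈ to ≤-respʳ; reflexive to ≤-reflexive)

  private
    module R = RingProperties ring
    module G = AbelianGroupProperties +-abelianGroup

  0≤1 : 0# ≤ 1#
  0≤1 with ≤-total 0# 1#
  ... | inj₁ p = p
  ... | inj₂ 1≤0 = ≤-respʳ
          (trans (sym (R.-‿distribˡ-* 1# (- 1#)))
            (trans (-‿cong (*-identityˡ (- 1#))) (G.⁻¹-involutive 1#)))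
          (*-nonneg 0≤-1 0≤-1)
    where
    0≤-1 : 0# ≤ - 1#
    0≤-1 = ≤-respˡ (-‿inverseˡ 1#)
             (≤-respʳ (+-identityʳ (- 1#)) (+-monoʳ-≤ (- 1#) 1≤0))

  1≤a⇒b≤ab : ∀ {a b} → 1# ≤ a → 0# ≤ b → b ≤ a * b
  1≤a⇒b≤ab {a} {b} 1≤a 0≤b =
    ≤-respˡ (+-identityʳ b) (≤-respʳ eq (+-monoʳ-≤ b (*-nonneg 0≤a-1 0≤b)))
    where
    0≤a-1 : 0# ≤ - 1# + a
    0≤a-1 = ≤-respˡ (-‿inverseˡ 1#) (+-monoʳ-≤ (- 1#) 1≤a)
    eq : b + (- 1# + a) * b ≈ a * b
    eq = trans (+-congˡ (trans (distribʳ b (- 1#) a) (+-congʳ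
           (trans (sym (R.-‿distribˡ-* 1# b)) (-‿cong (*-identityˡ b))))))
         (trans (sym (+-assoc b (- b) (a * b)))
           (trans (+-congʳ (-‿inverseʳ b)) (+-identityˡ (a * b))))

  a≤1∧b≤1⇒ab≤1 : ∀ {a b} → a ≤ 1# → 0# ≤ b → b ≤ 1# → a * b ≤ 1#
  a≤1∧b≤1⇒ab≤1 {a} {b} a≤1 0≤b b≤1 = ≤-trans ab≤b b≤1
    where
    0≤1-a : 0# ≤ - a + 1#
    0≤1-a = ≤-respˡ (-‿inverseˡ a) (+-monoʳ-≤ (- a) a≤1)
    eq : a * b + (- a + 1#) * b ≈ b
    eq = trans (sym (distribʳ b a (- a + 1#))) (trans (*-congʳ
           (trans (sym (+-assoc a (- a) 1#))
             (trans (+-congʳ (-‿inverseʳ a)) (+-identityˡ 1#))))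
           (*-identityˡ b))
    ab≤b : a * b ≤ b
    ab≤b = ≤-respˡ (+-identityʳ (a * b))
             (≤-respʳ eq (+-monoʳ-≤ (a * b) (*-nonneg 0≤1-a 0≤b)))

  0≤fromℕ : ∀ n → 0# ≤ fromℕ n
  1≤fromℕ : ∀ n → 1# ≤ fromℕ (suc n)

  0≤fromℕ zero    = ≤-reflexive (CommutativeRing.refl commutativeRing)
  0≤fromℕ (suc n) = ≤-trans 0≤1 (1≤fromℕ n)

  1≤fromℕ n = ≤-respˡ (+-identityʳ 1#) (+-monoʳ-≤ 1# (0≤fromℕ n))

  1≤a⇒a⁻¹≤1 : ∀ {a} → 1# ≤ a → a ⁻¹ ≤ 1#
  1≤a⇒a⁻¹≤1 {a} 1≤a with ≤-total (a ⁻¹) 1#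
  ... | inj₁ p = p
  ... | inj₂ q = ≤-respʳ (⁻¹-inverse a a≉0) (1≤a⇒b≤ab 1≤a (≤-trans 0≤1 q))
    where
    a≉0 : ¬ (a ≈ 0#)
    a≉0 a≈0 = 0≉1 (DecTotalOrder.antisym decTotalOrder 0≤1 (≤-respʳ a≈0 1≤a))

record FiniteField (q : ℕ) : Set₁ where
  field
    𝔽 : Field
  open Field 𝔽 public renaming (setoid to ≈-setoid)
  field
    enumeration : Inverse (setoid (Fin q)) ≈-setoid

-- The field 𝐅_q((x)).
module LaurentSeries {q : ℕ} (F : FiniteField q) where

  private module F = FiniteField F

  -- x^ n · a is Σ_{j ≥ 0} a_j x^{n+j}; a_0 may vanish.
  infix 6 x^_·_
  record Laurent : Set where
    constructor x^_·_
    field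
      order  : ℤ
      coeffs : ℕ → F.Carrier
  open Laurent public

  coeff : Laurent → ℤ → F.Carrier
  coeff z i with i ℤ.- order z
  ... | + j      = coeffs z j
  ... | -[1+ _ ] = F.0#

  infix 4 _≈ᴸ_
  _≈ᴸ_ : Rel Laurent 0ℓ
  z ≈ᴸ w = ∀ i → coeff z i F.≈ coeff w i

  const : F.Carrier → Laurent
  const α = x^ 0ℤ · λ { zero → α ; (suc _) → F.0# }

  0ᴸ 1ᴸ X : Laurent
  0ᴸ = const F.0#
  1ᴸ = const F.1#
  X  = x^ 1ℤ · coeffs 1ᴸ

  infixl 6 _+ᴸ_
  _+ᴸ_ : Laurent → Laurent → Laurent
  z +ᴸ w = x^ m · λ j → coeff z (m ℤ.+ + j) F.+ coeff w (m ℤ.+ + j)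
    where m = order z ℤ.⊓ order w

  -ᴸ_ : Laurent → Laurent
  -ᴸ z = x^ order z · λ j → F.- coeffs z j

  infixl 7 _*ᴸ_
  _*ᴸ_ : Laurent → Laurent → Laurent
  z *ᴸ w = x^ (order z ℤ.+ order w) · λ n →
    F.sum {suc n} λ j → coeffs z (toℕ j) F.* coeffs w (n ∸ toℕ j)

  rawRingᴸ : RawRing 0ℓ 0ℓ
  rawRingᴸ = record
    { Carrier = Laurent ; _≈_ = _≈ᴸ_ ; _+_ = _+ᴸ_ ; _*_ = _*ᴸ_
    ; -_ = -ᴸ_ ; 0# = 0ᴸ ; 1# = 1ᴸ }

  HasLeadingIndex : Laurent → ℤ → Set
  HasLeadingIndex z n =
    (∀ i → i ℤ.< n → coeff z i F.≈ F.0#) × ¬ (coeff z n F.≈ F.0#)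

-- A completion of an algebraic closure of 𝐅_q((x)): a complete
-- non-Archimedean valued field extending 𝐅_q((x)), with a dense subfield
-- that is an algebraic closure of 𝐅_q((x)).
record CompletedAlgebraicClosure
  (ℝ : CompleteOrderedField) {q : ℕ} (F : FiniteField q) : Set₁ where
  private module ℝ = CompleteOrderedField ℝ
  open LaurentSeries F
  field
    𝔽 : Field
  open Field 𝔽 public

  -- Σ_{j<d} a_j z^j + z^d
  evalMonic : ∀ {d} → Vector Carrier d → Carrier → Carrier
  evalMonic {d} a z = sum (λ j → a j * z ^ toℕ j) + z ^ d

  field
    ∣_∣       : Carrier → ℝ.Carrier
    ∣∣-cong   : ∀ {a b} → a ≈ b → ∣ a ∣ ℝ.≈ ∣ b ∣
    ∣∣-nonneg : ∀ a → ℝ.0# ℝ.≤ ∣ a ∣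
    ∣0∣       : ∣ 0# ∣ ℝ.≈ ℝ.0#
    ∣∣-definite : ∀ a → ∣ a ∣ ℝ.≈ ℝ.0# → a ≈ 0#
    ∣∣-*      : ∀ a b → ∣ a * b ∣ ℝ.≈ ∣ a ∣ ℝ.* ∣ b ∣
    ∣∣-+      : ∀ a b → ∣ a + b ∣ ℝ.≤ ∣ a ∣ ℝ.⊔ ∣ b ∣

    ι           : Laurent → Carrier
    ι-homo      : IsRingHomomorphism rawRingᴸ rawRing ι
    ∣∣-extends  : ∀ z n → HasLeadingIndex z n →
                  ∣ ι z ∣ ℝ.≈ ℝ.fromℕ q ℝ.^ℤ (ℤ.- n)

    K̄           : Pred Carrier 0ℓ
    K̄-resp-≈    : ∀ {a b} → a ≈ b → a ∈ K̄ → b ∈ K̄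
    K̄-ι         : ∀ z → ι z ∈ K̄
    K̄-+         : ∀ {a b} → a ∈ K̄ → b ∈ K̄ → a + b ∈ K̄
    K̄--         : ∀ {a} → a ∈ K̄ → - a ∈ K̄
    K̄-*         : ∀ {a b} → a ∈ K̄ → b ∈ K̄ → a * b ∈ K̄
    K̄-⁻¹        : ∀ {a} → ¬ (a ≈ 0#) → a ∈ K̄ → a ⁻¹ ∈ K̄
    K̄-algebraic : ∀ {a} → a ∈ K̄ →
                  ∃[ d ] Σ[ b ∈ Vector Laurent d ]
                    evalMonic (λ j → ι (b j)) a ≈ 0#
    K̄-closed    : ∀ {d} (b : Vector Carrier (suc d)) → (∀ j → b j ∈ K̄) →
                  ∃[ a ] (a ∈ K̄) × (evalMonic b a ≈ 0#)

    K̄-dense     : ∀ z ε → ℝ.0# ℝ.< ε →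
                  ∃[ a ] (a ∈ K̄) × (∣ z - a ∣ ℝ.< ε)
    complete    : (s : ℕ → Carrier) →
                  (∀ ε → ℝ.0# ℝ.< ε → ∃[ N ] ∀ m n → N ℕ.≤ m → N ℕ.≤ n →
                     ∣ s m - s n ∣ ℝ.< ε) →
                  ∃[ l ] ℝ.TendsToZero (λ n → ∣ s n - l ∣)

module Carlitz (ℝ : CompleteOrderedField) {q : ℕ} (F : FiniteField q)
               (C : CompletedAlgebraicClosure ℝ F) where

  private
    module ℝ = CompleteOrderedField ℝ
    module F = FiniteField F
  open LaurentSeries F
  open CompletedAlgebraicClosure C
  private module ι-homo = IsRingHomomorphism ι-homo

  q^_ : ℕ → ℝ.Carrier
  q^ n = ℝ.fromℕ q ℝ.^ n

  -- The absolute value of K = 𝐅_q((x)) is the restriction of that of C.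
  O : Set
  O = Σ[ z ∈ Laurent ] ∣ ι z ∣ ℝ.≤ ℝ.1#

  ∣const∣≤1 : ∀ α → ∣ ι (const α) ∣ ℝ.≤ ℝ.1#
  ∣X∣≤1 : ∣ ι X ∣ ℝ.≤ ℝ.1#

  infixl 6 _+ᴼ_
  _+ᴼ_ : O → O → O
  (z , ∣z∣≤1) +ᴼ (w , ∣w∣≤1) = z +ᴸ w ,
    ℝ.≤-respˡ (∣∣-cong (sym (ι-homo.+-homo z w)))
      (ℝ.≤-trans (∣∣-+ (ι z) (ι w)) (ℝ.⊔-lub ∣z∣≤1 ∣w∣≤1))

  private
    ∣*∣≤1 : ∀ z w → ∣ ι z ∣ ℝ.≤ ℝ.1# → ∣ ι w ∣ ℝ.≤ ℝ.1# →
            ∣ ι (z *ᴸ w) ∣ ℝ.≤ ℝ.1#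
    ∣*∣≤1 z w ∣z∣≤1 ∣w∣≤1 =
      ℝ.≤-respˡ (ℝ.sym (ℝ.trans (∣∣-cong (ι-homo.*-homo z w)) (∣∣-* (ι z) (ι w))))
        (ℝ.a≤1∧b≤1⇒ab≤1 ∣z∣≤1 (∣∣-nonneg (ι w)) ∣w∣≤1)

  infixr 7 _∙_ x∙_
  _∙_ : F.Carrier → O → O
  α ∙ (t , ∣t∣≤1) = const α *ᴸ t , ∣*∣≤1 (const α) t (∣const∣≤1 α) ∣t∣≤1

  x∙_ : O → O
  x∙ (t , ∣t∣≤1) = X *ᴸ t , ∣*∣≤1 X t ∣X∣≤1 ∣t∣≤1

  Nonzero : O → Set
  Nonzero (t , _) = ¬ (t ≈ᴸ 0ᴸ)

  ⟦_⟧ : O → Carrier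
  ⟦ t , _ ⟧ = ι t

  -- Continuity implies that u respects equality in K.
  Continuous : (O → Carrier) → Set
  Continuous u = ∀ t₀ ε → ℝ.0# ℝ.< ε → ∃[ δ ] (ℝ.0# ℝ.< δ) ×
    (∀ t → ∣ ⟦ t ⟧ - ⟦ t₀ ⟧ ∣ ℝ.< δ → ∣ u t - u t₀ ∣ ℝ.< ε)

  record C₀ (u : O → Carrier) : Set where
    field
      continuous  : Continuous u
      additive    : ∀ t₁ t₂ → u (t₁ +ᴼ t₂) ≈ u t₁ + u t₂
      homogeneous : ∀ α t → u (α ∙ t) ≈ ι (const α) * u t

  [_] : ℕ → Carrier
  [ i ] = ι X ^ (q ℕ.^ i) - ι X

  D : ℕ → Carrier
  D i = product {i} λ j → [ i ∸ toℕ j ] ^ (q ℕ.^ toℕ j)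

  -- The polynomial Σ_{j<i} a_j x^j, where the index runs through the
  -- q^i possible coefficient vectors.
  poly : ∀ i → Fin (q ℕ.^ i) → Carrier
  poly i a = sum {i} λ j → ι (const (Inverse.to F.enumeration (finToFun a j)))
                           * ι X ^ toℕ j

  e : ℕ → O → Carrier
  e zero    t = ⟦ t ⟧
  e (suc i) t = product λ a → ⟦ t ⟧ - poly (suc i) a

  f : ℕ → O → Carrier
  f i t = D i ⁻¹ * e i t

  record IsCarlitzExpansion (u : O → Carrier) (c : ℕ → Carrier) : Set where
    field
      coefficients→0 : ℝ.TendsToZero λ n → ∣ c n ∣
      uniform : ∀ ε → ℝ.0# ℝ.< ε → ∃[ N ] ∀ n → N ℕ.≤ n → ∀ t →
                ∣ u t - sum {n} (λ i → c (toℕ i) * f (toℕ i) t) ∣ ℝ.< ε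

  Δ : ℕ → (O → Carrier) → O → Carrier
  Δ zero    u t = u t
  Δ (suc n) u t = Δ n u (x∙ t) - ι X ^ (q ℕ.^ n) * Δ n u t

  -- Only meaningful at nonzero t.
  𝔇 : ℕ → (O → Carrier) → O → Carrier
  𝔇 k u t = (⟦ t ⟧ ^ (q ℕ.^ k)) ⁻¹ * Δ k u t

  record IsContinuousExtensionOf𝔇 (k : ℕ) (u g : O → Carrier) : Set where
    field
      continuous : Continuous g
      extends    : ∀ t → Nonzero t → g t ≈ 𝔇 k u t

  -- C₀^[1+ k ] is the space C₀^{k+1}(O, K̄_c).
  C₀^[1+_] : ℕ → (O → Carrier) → Set
  C₀^[1+ k ] u = C₀ u × (∃[ g ] IsContinuousExtensionOf𝔇 k u g)

  private
    1≤q : ℝ.1# ℝ.≤ ℝ.fromℕ q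
    1≤q = go q (Inverse.from F.enumeration F.0#)
      where
      go : ∀ n → Fin n → ℝ.1# ℝ.≤ ℝ.fromℕ n
      go (suc n) _ = ℝ.1≤fromℕ n

    const-below : ∀ α i → i ℤ.< 0ℤ → coeff (const α) i F.≈ F.0#
    const-below α (+ _)    (ℤ.+<+ ())
    const-below α -[1+ n ] ℤ.-<+ = F.refl

    X-below : ∀ i → i ℤ.< 1ℤ → coeff X i F.≈ F.0#
    X-below (+ zero)  _ = F.refl
    X-below (+ suc _) (ℤ.+<+ (ℕ.s≤s ()))
    X-below -[1+ n ]  _ = F.refl

  ∣X∣≤1 = ℝ.≤-respˡ
    (ℝ.sym (ℝ.trans (∣∣-extends X 1ℤ (X-below , λ p → F.0≉1 (F.sym p)))
                    (ℝ.*-identityʳ (ℝ.fromℕ q ℝ.⁻¹))))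
    (ℝ.1≤a⇒a⁻¹≤1 1≤q)

  -- By decidability of ≤ on ℝ: if |α| ≰ 1 then α ≠ 0, whence |α| = 1.
  ∣const∣≤1 α with DecTotalOrder._≤?_ ℝ.decTotalOrder ∣ ι (const α) ∣ ℝ.1#
  ... | yes p = p
  ... | no ¬p = ⊥-elim (¬p (ℝ.≤-reflexive
          (∣∣-extends (const α) 0ℤ (const-below α , α≉0))))
    where
    α≉0 : ¬ (α F.≈ F.0#)
    α≉0 α≈0 = ¬p (ℝ.≤-respˡ
      (ℝ.sym (ℝ.trans (∣∣-cong (trans (ι-homo.⟦⟧-cong const≈0) ι-homo.0#-homo)) ∣0∣))
      ℝ.0≤1)
      where
      const≈0 : const α ≈ᴸ 0ᴸ
      const≈0 (+ zero)  = α≈0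
      const≈0 (+ suc _) = F.refl
      const≈0 -[1+ _ ]  = F.refl

{-# OPTIONS --safe #-}

-- Since Δ f_i = f_{i-1}^q, one has 𝔇ᵏu(t) = Σ_i c_{k+i} (f_i(t)/t)^{q^k}, where |f_i(t)/t| ≤ q^i on O.
-- If q^{n q^k} |c_n| → 0, this series converges uniformly and is the continuous extension.
-- Conversely c_n = Δⁿu(1). If g extends 𝔇ᵏu, then W n j = Δ^{n+k}u(x^j) / x^{(n+j)q^k} is obtained from
-- W 0 j = g(x^j) by W (n+1) j = W n (j+1) − x^{q^{n+k}-q^k} W n j. So |W n 0| = q^{n q^k} |c_{n+k}| is at most
-- some |g(x^j)|, and it tends to 0 because W 1 j = g(x^{j+1}) − g(x^j) does and the later multipliers are at most q^{-1}.
module Submission where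

open import Defs
open import Level using (0ℓ)
open import Algebra.Bundles using (CommutativeRing)
open import Algebra.Bundles.Raw using (RawRing)
import Algebra.Construct.NaturalChoice.Max as Max
open import Algebra.Morphism.Structures using (IsRingHomomorphism)
import Algebra.Properties.AbelianGroup as AbelianGroupProperties
import Algebra.Properties.CommutativeMonoid.Sum as CommutativeMonoidSum
import Algebra.Properties.CommutativeSemigroup as CommutativeSemigroupProperties
import Algebra.Properties.CommutativeSemiring.Exp as Exp
import Algebra.Properties.Ring as RingProperties
import Algebra.Properties.Semiring.Mult as SemiringMult
import Algebra.Properties.Semiring.Sum as SemiringSum
import Algebra.Solver.Ring as RingSolver
open import Algebra.Solver.Ring.AlmostCommutativeRing using (fromCommutativeRing; _-Raw-AlmostCommutative⟶_)
open import Data.Empty using (⊥-elim)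
open import Data.Fin.Base using (Fin; zero; suc; toℕ; _↑ˡ_; _↑ʳ_; combine; finToFun)
import Data.Fin.Permutation as Perm
import Data.Fin.Properties as Fin
open import Data.Integer.Base as ℤ using (ℤ; +_; -[1+_]; 0ℤ; 1ℤ)
import Data.Integer.Properties as ℤ
open import Data.Maybe.Base using (Maybe; just; nothing)
open import Data.Nat.Base as ℕ using (ℕ; zero; suc; z≤n; s≤s; _∸_)
open import Data.Nat.Primality using (Prime)
import Data.Nat.Properties as ℕ
open import Data.Product using (Σ-syntax; ∃-syntax; _×_; _,_; proj₁; proj₂)
open import Data.Sum.Base as Sum using (_⊎_; inj₁; inj₂; [_,_]′)
open import Data.Unit.Base using (⊤; tt)
open import Function.Base using (_∘_)
open import Function.Bundles using (Inverse; _⇔_; mk⇔)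
open import Relation.Binary using (DecTotalOrder)
import Relation.Binary.Construct.NonStrictToStrict as NonStrictToStrict
import Relation.Binary.Properties.DecTotalOrder as DecTotalOrderProperties
open import Relation.Binary.PropositionalEquality as ≡ using (_≡_; _≢_)
import Relation.Binary.Reasoning.PartialOrder as PartialOrderReasoning
import Relation.Binary.Reasoning.Setoid as SetoidReasoning
open import Relation.Nullary using (¬_; Dec; yes; no)
open import Relation.Nullary.Decidable using (toSum)

-- Two obstacles lie behind the bound on `f_i(t)/t`. The f_i are given as products over polynomials
-- divided by D_i, a form that shows neither their linearity nor their size. They are replaced by
-- the recursion [i+1] f_{i+1} = f_i^q - f_i, from which linearity, the difference rule and f_i(x^i)
-- = 1 follow inductively. This rests on (a + b)^q = a^q + b^q, obtained by comparing roots of monic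
-- polynomials in place of divisibility of binomial coefficients. Secondly, |f_i| ≤ 1 on O comes
-- from expanding t digit by digit: a crude polynomial bound improves by a factor q per digit unless
-- the value is already at most 1. In the converse direction the multiplier at n = 0 is 1, because
-- Δ^{k+1} multiplies by exactly the power x^{q^k} that the normalization removes. The first row
-- step gains nothing in size, so continuity of g at 0 must enter there. The supremum is taken on
-- the coefficient side; each W n 0 is dominated by a single g(x^j), so the values of g at powers of
-- x already approach it.

-- Ring solver over an arbitrary commutative ring, with integer coefficients.

-- Coefficients are formal differences (m , n) of naturals.
module IntegerCoefficients (R : CommutativeRing 0ℓ 0ℓ) where
  open CommutativeRing R
  open SemiringMult semiring using (×-homo-+; ×1-homo-*; ×-congˡ) renaming (_×_ to _·_)
  open RingProperties ring using (-‿distribˡ-*; -‿distribʳ-*; -0#≈0#)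
  open AbelianGroupProperties +-abelianGroup using (⁻¹-∙-comm; ⁻¹-involutive; ⁻¹-anti-homo-∙)
  open CommutativeSemigroupProperties +-commutativeSemigroup using (interchange)
  open SetoidReasoning setoid

  coefficients : RawRing 0ℓ 0ℓ
  coefficients = record
    { Carrier = ℕ × ℕ
    ; _≈_ = _≡_
    ; _+_ = λ (a , b) (c , d) → a ℕ.+ c , b ℕ.+ d
    ; _*_ = λ (a , b) (c , d) → a ℕ.* c ℕ.+ b ℕ.* d , a ℕ.* d ℕ.+ b ℕ.* c
    ; -_  = λ (a , b) → b , a
    ; 0#  = 0 , 0
    ; 1#  = 1 , 0
    }

  value : ℕ × ℕ → Carrier
  value (a , b) = a · 1# - b · 1#

  private
    cross : ∀ {a b c d} → a + d ≈ c + b → a - b ≈ c - d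
    cross {a} {b} {c} {d} eq = begin
      a - b                 ≈⟨ +-congʳ (sym (trans (+-assoc a d (- d)) (trans (+-congˡ (-‿inverseʳ d)) (+-identityʳ a)))) ⟩
      a + d - d - b         ≈⟨ +-congʳ (+-congʳ eq) ⟩
      c + b - d - b         ≈⟨ +-congʳ (trans (+-assoc c b (- d)) (trans (+-congˡ (+-comm b (- d))) (sym (+-assoc c (- d) b)))) ⟩
      c - d + b - b         ≈⟨ trans (+-assoc (c - d) b (- b)) (trans (+-congˡ (-‿inverseʳ b)) (+-identityʳ (c - d))) ⟩
      c - d                 ∎

    value-+ : ∀ x y → value (RawRing._+_ coefficients x y) ≈ value x + value y
    value-+ (a , b) (c , d) = begin
      (a ℕ.+ c) · 1# - (b ℕ.+ d) · 1#             ≈⟨ +-cong (×-homo-+ 1# a c) (-‿cong (×-homo-+ 1# b d)) ⟩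
      a · 1# + c · 1# - (b · 1# + d · 1#)          ≈⟨ +-congˡ (sym (⁻¹-∙-comm (b · 1#) (d · 1#))) ⟩
      a · 1# + c · 1# + (- (b · 1#) + - (d · 1#))  ≈⟨ interchange _ _ _ _ ⟩
      value (a , b) + value (c , d)                ∎

    value-neg : ∀ x → value (RawRing.-_ coefficients x) ≈ - value x
    value-neg (a , b) = begin
      b · 1# - a · 1#          ≈⟨ +-congʳ (⁻¹-involutive (b · 1#)) ⟨
      - - (b · 1#) - a · 1#    ≈⟨ ⁻¹-anti-homo-∙ (a · 1#) (- (b · 1#)) ⟨
      - (a · 1# - b · 1#)      ∎

    value-* : ∀ x y → value (RawRing._*_ coefficients x y) ≈ value x * value y
    value-* (a , b) (c , d) = begin
      (a ℕ.* c ℕ.+ b ℕ.* d) · 1# - (a ℕ.* d ℕ.+ b ℕ.* c) · 1#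
        ≈⟨ +-cong (hom a c b d) (-‿cong (hom a d b c)) ⟩
      (A * C + B * D) - (A * D + B * C)
        ≈⟨ +-congˡ (trans (-‿cong (+-comm _ _)) (sym (⁻¹-∙-comm _ _))) ⟩
      (A * C + B * D) + (- (B * C) - A * D)
        ≈⟨ +-congˡ (+-comm _ _) ⟩
      (A * C + B * D) + (- (A * D) - B * C)
        ≈⟨ interchange _ _ _ _ ⟩
      (A * C - A * D) + (B * D - B * C)
        ≈⟨ +-cong (+-congˡ (-‿distribʳ-* A D)) (+-comm _ _) ⟩
      (A * C + A * - D) + (- (B * C) + B * D)
        ≈⟨ +-cong (sym (distribˡ A C (- D))) (+-congˡ (sym (trans (-‿cong (sym (-‿distribʳ-* B D))) (⁻¹-involutive _)))) ⟩
      A * (C - D) + (- (B * C) + - (B * - D))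
        ≈⟨ +-congˡ (trans (⁻¹-∙-comm _ _) (-‿cong (sym (distribˡ B C (- D))))) ⟩
      A * (C - D) - B * (C - D)
        ≈⟨ +-congˡ (-‿distribˡ-* B (C - D)) ⟩
      A * (C - D) + - B * (C - D)
        ≈⟨ distribʳ (C - D) A (- B) ⟨
      value (a , b) * value (c , d) ∎
      where
      A = a · 1# ; B = b · 1# ; C = c · 1# ; D = d · 1#
      hom : ∀ m n k l → (m ℕ.* n ℕ.+ k ℕ.* l) · 1# ≈ (m · 1#) * (n · 1#) + (k · 1#) * (l · 1#)
      hom m n k l = trans (×-homo-+ 1# (m ℕ.* n) (k ℕ.* l)) (+-cong (×1-homo-* m n) (×1-homo-* k l))

    morphism : coefficients -Raw-AlmostCommutative⟶ fromCommutativeRing R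
    morphism = record
      { ⟦_⟧ = value
      ; +-homo = value-+
      ; *-homo = value-*
      ; -‿homo = value-neg
      ; 0-homo = -‿inverseʳ 0#
      ; 1-homo = trans (+-cong (+-identityʳ 1#) -0#≈0#) (+-identityʳ 1#)
      }

    -- One integer has many presentations as a difference, for instance (1 , 1) and (0 , 0), so the
    -- test compares cross sums and not the pairs themselves.
    equal? : ∀ x y → Maybe (value x ≈ value y)
    equal? (a , b) (c , d) with (a ℕ.+ d) ℕ.≟ (c ℕ.+ b)
    ... | yes p = just (cross (trans (sym (×-homo-+ 1# a d)) (trans (×-congˡ p) (×-homo-+ 1# c b))))
    ... | no  _ = nothing

  open RingSolver coefficients (fromCommutativeRing R) morphism equal? public
    using (solve; _:=_; _:+_; _:*_; _:-_; :-_; con)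

-- Fields: cancellation, finite products, roots of monic polynomials, additivity of Frobenius.

module FieldProperties (𝔽 : Field) where
  open Field 𝔽 hiding (zero)
  open IntegerCoefficients commutativeRing
  open Exp commutativeSemiring public using (^-congˡ; ^-congʳ; ^-homo-*; ^-assocʳ; ^-distrib-*)
  open CommutativeMonoidSum *-commutativeMonoid public
    using () renaming (sum-cong-≋ to product-cong; ∑-distrib-+ to product-distrib-*; ∑-comm to product-comm; sum-replicate to product-const; sum-permute to product-permute)
  open SemiringSum semiring public using (*-distribˡ-sum) renaming (sum-cong-≋ to sum-cong)
  open SetoidReasoning setoid

  a-0≈a : ∀ a → a - 0# ≈ a
  a-0≈a a = trans (+-congˡ (RingProperties.-0#≈0# ring)) (+-identityʳ a)

  ⁻¹-cancelˡ : ∀ {a} → ¬ (a ≈ 0#) → ∀ b → a ⁻¹ * (a * b) ≈ b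
  ⁻¹-cancelˡ {a} a≉0 b = begin
    a ⁻¹ * (a * b)  ≈⟨ solve 3 (λ x y z → x :* (y :* z) := (y :* x) :* z) refl (a ⁻¹) a b ⟩
    (a * a ⁻¹) * b  ≈⟨ *-congʳ (⁻¹-inverse a a≉0) ⟩
    1# * b          ≈⟨ *-identityˡ b ⟩
    b               ∎

  ⁻¹-cancelʳ : ∀ {a} → ¬ (a ≈ 0#) → ∀ b → a * (a ⁻¹ * b) ≈ b
  ⁻¹-cancelʳ {a} a≉0 b = trans (solve 3 (λ x y z → y :* (x :* z) := x :* (y :* z)) refl (a ⁻¹) a b) (⁻¹-cancelˡ a≉0 b)

  *-cancelˡ : ∀ {a b c} → ¬ (a ≈ 0#) → a * b ≈ a * c → b ≈ c
  *-cancelˡ {a} {b} {c} a≉0 eq = trans (sym (⁻¹-cancelˡ a≉0 b)) (trans (*-congˡ eq) (⁻¹-cancelˡ a≉0 c))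

  a*b≈0⇒b≈0 : ∀ {a b} → ¬ (a ≈ 0#) → a * b ≈ 0# → b ≈ 0#
  a*b≈0⇒b≈0 {a} a≉0 eq = *-cancelˡ a≉0 (trans eq (sym (zeroʳ a)))

  a-b≈0⇒a≈b : ∀ {a b} → a - b ≈ 0# → a ≈ b
  a-b≈0⇒a≈b {a} {b} eq = begin
    a          ≈⟨ solve 2 (λ a b → a := (a :- b) :+ b) refl a b ⟩
    a - b + b  ≈⟨ +-congʳ eq ⟩
    0# + b     ≈⟨ +-identityˡ b ⟩
    b          ∎

  a≈b⇒a-b≈0 : ∀ {a b} → a ≈ b → a - b ≈ 0#
  a≈b⇒a-b≈0 {a} {b} eq = trans (+-congʳ eq) (-‿inverseʳ b)

  *-nonzero : ∀ {a b} → ¬ (a ≈ 0#) → ¬ (b ≈ 0#) → ¬ (a * b ≈ 0#)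
  *-nonzero a≉0 b≉0 eq = b≉0 (a*b≈0⇒b≈0 a≉0 eq)

  ^-nonzero : ∀ {a} → ¬ (a ≈ 0#) → ∀ n → ¬ (a ^ n ≈ 0#)
  ^-nonzero a≉0 zero    = 0≉1 ∘ sym
  ^-nonzero a≉0 (suc n) = *-nonzero a≉0 (^-nonzero a≉0 n)

  product-nonzero : ∀ {n} (v : Fin n → Carrier) → (∀ i → ¬ (v i ≈ 0#)) → ¬ (product v ≈ 0#)
  product-nonzero {zero}  v v≉0 = 0≉1 ∘ sym
  product-nonzero {suc n} v v≉0 = *-nonzero (v≉0 zero) (product-nonzero (v ∘ suc) (v≉0 ∘ suc))

  product-^ : ∀ {n} (v : Fin n → Carrier) m → product v ^ m ≈ product (λ i → v i ^ m)
  product-^ {zero}  v zero    = refl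
  product-^ {zero}  v (suc m) = trans (*-identityˡ _) (product-^ v m)
  product-^ {suc n} v m       = trans (^-distrib-* _ _ m) (*-congˡ (product-^ (v ∘ suc) m))

  1^ : ∀ n → 1# ^ n ≈ 1#
  1^ zero    = refl
  1^ (suc n) = trans (*-identityˡ _) (1^ n)

  ^-suc∸1 : ∀ a n → 1 ℕ.≤ n → a ^ n ≈ a * a ^ (n ℕ.∸ 1)
  ^-suc∸1 a (suc n) _ = refl

  0^ : ∀ n → 1 ℕ.≤ n → 0# ^ n ≈ 0#
  0^ (suc n) _ = zeroˡ _

  product-+ : ∀ m n (v : Fin (m ℕ.+ n) → Carrier) →
              product v ≈ product (λ i → v (i ↑ˡ n)) * product (λ j → v (m ↑ʳ j))
  product-+ zero    n v = sym (*-identityˡ _)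
  product-+ (suc m) n v = trans (*-congˡ (product-+ m n (v ∘ suc))) (sym (*-assoc _ _ _))

  product-combine : ∀ m n (v : Fin (m ℕ.* n) → Carrier) →
                    product v ≈ product (λ i → product (λ j → v (combine {m} i j)))
  product-combine zero    n v = refl
  product-combine (suc m) n v = trans (product-+ n (m ℕ.* n) v) (*-congˡ (product-combine m n (λ a → v (n ↑ʳ a))))

  sum-zero : ∀ n {v : Fin n → Carrier} → (∀ i → v i ≈ 0#) → sum v ≈ 0#
  sum-zero zero    v≈0 = refl
  sum-zero (suc n) v≈0 = trans (+-cong (v≈0 zero) (sum-zero n (v≈0 ∘ suc))) (+-identityˡ 0#)

  sum-single : ∀ m (a : ℕ → Carrier) n → n ℕ.< m → (∀ i → i ≢ n → a i ≈ 0#) → sum {m} (λ i → a (toℕ i)) ≈ a n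
  sum-single (suc m) a zero    _         a≈0 = trans (+-congˡ (sum-zero m λ i → a≈0 (suc (toℕ i)) (λ ()))) (+-identityʳ _)
  sum-single (suc m) a (suc n) (s≤s n<m) a≈0 = trans (+-congʳ (a≈0 0 (λ ())))
    (trans (+-identityˡ _) (sum-single m (a ∘ suc) n n<m (λ i i≢n → a≈0 (suc i) (i≢n ∘ ℕ.suc-injective))))

  sum-split : ∀ m n (a : ℕ → Carrier) →
              sum {m ℕ.+ n} (λ i → a (toℕ i)) ≈ sum {m} (λ i → a (toℕ i)) + sum {n} (λ i → a (m ℕ.+ toℕ i))
  sum-split zero    n a = sym (+-identityˡ _)
  sum-split (suc m) n a = trans (+-congˡ (sum-split m n (a ∘ suc))) (sym (+-assoc _ _ _))

  -- Horner form of a monic polynomial. Being monic is a property of a function up to pointwise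
  -- equality, so coefficients never have to be listed.
  data Monic : ℕ → (Carrier → Carrier) → Set where
    one  : ∀ {f} → (∀ y → f y ≈ 1#) → Monic 0 f
    step : ∀ {d f} a {g} → Monic d g → (∀ y → f y ≈ a + y * g y) → Monic (suc d) f

  Monic-cong : ∀ {d f g} → Monic d f → (∀ y → g y ≈ f y) → Monic d g
  Monic-cong (one eq)      g≈f = one λ y → trans (g≈f y) (eq y)
  Monic-cong (step a m eq) g≈f = step a m λ y → trans (g≈f y) (eq y)

  Monic-+-lower : ∀ {d e f g} → Monic d f → Monic e g → e ℕ.< d → ∀ r →
                  Monic d (λ y → f y + r * g y)
  Monic-+-lower {f = f} {g} (step a {f′} mf eqf) (one eqg) e<d r = step (a + r) mf λ y → begin
    f y + r * g y           ≈⟨ +-cong (eqf y) (trans (*-congˡ (eqg y)) (*-identityʳ r)) ⟩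
    a + y * f′ y + r        ≈⟨ solve 3 (λ a b c → a :+ b :+ c := (a :+ c) :+ b) refl a (y * f′ y) r ⟩
    (a + r) + y * f′ y      ∎
  Monic-+-lower {f = f} {g} (step a {f′} mf eqf) (step b {g′} mg eqg) (s≤s e<d) r =
    step (a + r * b) (Monic-+-lower mf mg e<d r) λ y → begin
      f y + r * g y                              ≈⟨ +-cong (eqf y) (*-congˡ (eqg y)) ⟩
      a + y * f′ y + r * (b + y * g′ y)
        ≈⟨ solve 6 (λ a y f r b g → a :+ y :* f :+ r :* (b :+ y :* g) := (a :+ r :* b) :+ y :* (f :+ r :* g))
             refl a y (f′ y) r b (g′ y) ⟩
      (a + r * b) + y * (f′ y + r * g′ y)        ∎

  -- Synthetic division: if f(y) = a + y f′(y) and g′ is the quotient of f′ by y - r, then f′ + r g′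
  -- is the quotient of f. Its remainder f(r) is a value of f, hence vanishes at a root.
  Monic-divide : ∀ {d f} → Monic (suc d) f → ∀ r →
                 ∃[ g ] Monic d g × (∀ y → f y ≈ f r + (y - r) * g y)
  Monic-divide {f = f} (step a {f′} m@(one eq′) eq) r = f′ , m , λ y → begin
    f y                                 ≈⟨ eq y ⟩
    a + y * f′ y                        ≈⟨ solve 4 (λ a y f r → a :+ y :* f := (a :+ r :* f) :+ (y :- r) :* f) refl a y (f′ y) r ⟩
    (a + r * f′ y) + (y - r) * f′ y     ≈⟨ +-congʳ (+-congˡ (*-congˡ (trans (eq′ y) (sym (eq′ r))))) ⟩
    (a + r * f′ r) + (y - r) * f′ y     ≈⟨ +-congʳ (eq r) ⟨
    f r + (y - r) * f′ y                ∎
  Monic-divide {f = f} (step a {f′} m@(step _ _ _) eq) r with Monic-divide m r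
  ... | g′ , mg , eqg = (λ y → f′ y + r * g′ y) , Monic-+-lower m mg ℕ.≤-refl r , λ y → begin
    f y                                 ≈⟨ eq y ⟩
    a + y * f′ y                        ≈⟨ solve 4 (λ a y f r → a :+ y :* f := (a :+ r :* f) :+ (y :- r) :* f) refl a y (f′ y) r ⟩
    (a + r * f′ y) + (y - r) * f′ y     ≈⟨ +-congʳ (+-congˡ (*-congˡ (eqg y))) ⟩
    (a + r * (f′ r + (y - r) * g′ y)) + (y - r) * f′ y
      ≈⟨ solve 6 (λ a r f d g h → (a :+ r :* (f :+ d :* g)) :+ d :* h := (a :+ r :* f) :+ d :* (h :+ r :* g))
           refl a r (f′ r) (y - r) (g′ y) (f′ y) ⟩
    (a + r * f′ r) + (y - r) * (f′ y + r * g′ y)  ≈⟨ +-congʳ (eq r) ⟨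
    f r + (y - r) * (f′ y + r * g′ y)             ∎

  -- The quotient by y - v₀ still vanishes at every other root, since the differences of the roots
  -- are invertible. As many roots as the degree leave only the constant quotient 1.
  Monic-roots : ∀ {d f} → Monic d f → (v : Fin d → Carrier) →
                (∀ {i j} → i ≢ j → ¬ (v i ≈ v j)) → (∀ i → f (v i) ≈ 0#) →
                ∀ y → f y ≈ product (λ i → y - v i)
  Monic-roots (one eq) v distinct roots y = eq y
  Monic-roots {suc d} {f} m@(step _ _ _) v distinct roots y with Monic-divide m (v zero)
  ... | g , mg , eq = trans (factor y) (*-congˡ (Monic-roots mg (v ∘ suc) (λ i≢j → distinct (i≢j ∘ Fin.suc-injective)) roots′ y))
    where
    factor : ∀ y → f y ≈ (y - v zero) * g y
    factor y = trans (eq y) (trans (+-congʳ (roots zero)) (+-identityˡ _))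
    roots′ : ∀ i → g (v (suc i)) ≈ 0#
    roots′ i = a*b≈0⇒b≈0 (λ p → distinct (λ ()) (a-b≈0⇒a≈b p)) (trans (sym (factor (v (suc i)))) (roots (suc i)))

  -- The distributive law (y + b)^{n+1} = y (y + b)^n + b (y + b)^n raises the degree without any
  -- binomial coefficient.
  Monic-^ : ∀ b n → Monic n (λ y → (y + b) ^ n)
  Monic-^ b zero    = one λ _ → refl
  Monic-^ b (suc n) = Monic-cong
    (Monic-+-lower (step 0# (Monic-^ b n) λ _ → sym (+-identityˡ _)) (Monic-^ b n) ℕ.≤-refl b)
    λ y → distribʳ ((y + b) ^ n) y b

  Monic-id : Monic 1 (λ y → y)
  Monic-id = step 0# (one λ _ → refl) λ y → trans (sym (*-identityʳ y)) (sym (+-identityˡ _))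

  -- If τ enumerates a copy of 𝐅_q, then y^q − b^{q-1} y and (y + b)^q − b^q − b^{q-1} y
  -- are monic of degree q and share the q distinct roots b τᵢ.
  module _ {q} (2≤q : 2 ℕ.≤ q) (τ : Fin q → Carrier) (distinct : ∀ {i j} → i ≢ j → ¬ (τ i ≈ τ j))
           (τ^q : ∀ i → τ i ^ q ≈ τ i) where

    private
      1≤q : 1 ℕ.≤ q
      1≤q = ℕ.≤-trans (s≤s z≤n) 2≤q

      Monic-y^q-by : ∀ b → Monic q (λ y → y ^ q - b * y)
      Monic-y^q-by b = Monic-cong (Monic-+-lower (Monic-^ 0# q) Monic-id 2≤q (- b)) λ y →
        +-cong (^-congˡ q (sym (+-identityʳ y))) (solve 2 (λ b y → :- (b :* y) := (:- b) :* y) refl b y)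

      b^q : ∀ b → b ^ q ≈ b * b ^ (q ℕ.∸ 1)
      b^q b = ^-suc∸1 b q 1≤q

    product-τ : ∀ y → product (λ i → y - τ i) ≈ y ^ q - y
    product-τ y = sym (trans (+-congˡ (-‿cong (sym (*-identityˡ y)))) (Monic-roots (Monic-y^q-by 1#) τ distinct
      (λ i → a≈b⇒a-b≈0 (trans (τ^q i) (sym (*-identityˡ _)))) y))

    frobenius-+ : (∀ i → (τ i + 1#) ^ q ≈ τ i + 1#) → (∀ b → Dec (b ≈ 0#)) →
                  ∀ a b → (a + b) ^ q ≈ a ^ q + b ^ q
    frobenius-+ τ+1^q _≈0? a b with b ≈0?
    -- For b = 0 the proposed roots b τᵢ all coincide, so this case is separate.
    ... | yes b≈0 = trans (^-congˡ q (trans (+-congˡ b≈0) (+-identityʳ a)))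
                      (sym (trans (+-congˡ (trans (^-congˡ q b≈0) (0^ q 1≤q))) (+-identityʳ _)))
    ... | no b≉0 = begin
      (a + b) ^ q                                  ≈⟨ solve 3 (λ x y z → x := (x :- y :- z) :+ (y :+ z)) refl ((a + b) ^ q) (b ^ q) (c * a) ⟩
      (a + b) ^ q - b ^ q - c * a + (b ^ q + c * a)  ≈⟨ +-congʳ (trans (Monic-roots monic bτ bτ-distinct roots a)
                                                        (sym (Monic-roots (Monic-y^q-by c) bτ bτ-distinct roots′ a))) ⟩
      a ^ q - c * a + (b ^ q + c * a)                ≈⟨ solve 3 (λ x y z → (x :- z) :+ (y :+ z) := x :+ y) refl (a ^ q) (b ^ q) (c * a) ⟩
      a ^ q + b ^ q                                  ∎
      where
      c = b ^ (q ℕ.∸ 1)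
      bτ : Fin q → Carrier
      bτ i = b * τ i
      bτ-distinct : ∀ {i j} → i ≢ j → ¬ (bτ i ≈ bτ j)
      bτ-distinct i≢j p = distinct i≢j (*-cancelˡ b≉0 p)
      monic : Monic q (λ y → (y + b) ^ q - b ^ q - c * y)
      monic = Monic-cong
        (Monic-+-lower (Monic-+-lower (Monic-^ b q) (one λ _ → refl) 1≤q (- (b ^ q))) Monic-id 2≤q (- c))
        λ y → +-cong (+-congˡ (sym (*-identityʳ _))) (solve 2 (λ c y → :- (c :* y) := (:- c) :* y) refl c y)
      -- Here (b τᵢ + b)^q = b^q (τᵢ + 1)^q, and τᵢ + 1 is fixed by the q-th power by hypothesis;
      -- with b^q = b c the three terms cancel.
      roots : ∀ i → (bτ i + b) ^ q - b ^ q - c * bτ i ≈ 0#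
      roots i = begin
        (b * τ i + b) ^ q - b ^ q - c * (b * τ i)
          ≈⟨ +-cong (+-cong (trans (^-congˡ q (trans (+-congˡ (sym (*-identityʳ b))) (sym (distribˡ b (τ i) 1#))))
               (trans (^-distrib-* b _ q) (*-cong (b^q b) (τ+1^q i)))) (-‿cong (trans (b^q b) (sym (*-identityʳ _))))) refl ⟩
        (b * c) * (τ i + 1#) - b * c * 1# - c * (b * τ i)
          ≈⟨ solve 4 (λ b c t o → (b :* c) :* (t :+ o) :- b :* c :* o :- c :* (b :* t) := con (0 , 0)) refl b c (τ i) 1# ⟩
        0# - 0# ≈⟨ -‿inverseʳ 0# ⟩
        0# ∎
      roots′ : ∀ i → bτ i ^ q - c * bτ i ≈ 0#
      roots′ i = begin
        (b * τ i) ^ q - c * (b * τ i)  ≈⟨ +-congʳ (trans (^-distrib-* b _ q) (*-cong (b^q b) (τ^q i))) ⟩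
        (b * c) * τ i - c * (b * τ i)  ≈⟨ solve 3 (λ b c t → (b :* c) :* t :- c :* (b :* t) := con (0 , 0)) refl b c (τ i) ⟩
        0# - 0#                        ≈⟨ -‿inverseʳ 0# ⟩
        0#                             ∎

-- Finite fields: decidable equality and Fermat's theorem.

module FiniteFieldProperties {q} (F : FiniteField q) where
  open FiniteField F hiding (zero)
  open FieldProperties 𝔽
  open Inverse enumeration using (to; from; from-cong; strictlyInverseˡ; strictlyInverseʳ)
  open SetoidReasoning ≈-setoid

  infix 4 _≈?_
  _≈?_ : ∀ a b → Dec (a ≈ b)
  a ≈? b with from a Fin.≟ from b
  ... | yes p = yes (trans (sym (strictlyInverseˡ a)) (trans (reflexive (≡.cong to p)) (strictlyInverseˡ b)))
  ... | no ¬p = no (¬p ∘ from-cong)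

  to-injective : ∀ {i j} → to i ≈ to j → i ≡ j
  to-injective {i} {j} p = ≡.trans (≡.sym (strictlyInverseʳ i)) (≡.trans (from-cong p) (strictlyInverseʳ j))

  private
    distinct⇒2≤ : ∀ {n} (i j : Fin n) → i ≢ j → 2 ℕ.≤ n
    distinct⇒2≤ {suc zero}    zero zero i≢j = ⊥-elim (i≢j ≡.refl)
    distinct⇒2≤ {suc (suc n)} _    _    _   = s≤s (s≤s z≤n)

  2≤q : 2 ℕ.≤ q
  2≤q = distinct⇒2≤ (from 0#) (from 1#) λ p →
    0≉1 (trans (sym (strictlyInverseˡ 0#)) (trans (reflexive (≡.cong to p)) (strictlyInverseˡ 1#)))

  private
    product-single : ∀ {n} (v : Fin n → Carrier) i → (∀ j → j ≢ i → v j ≈ 1#) → product v ≈ v i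
    product-single {suc n} v zero    v≈1 = trans (*-congˡ (trans (product-cong {n} (λ j → v≈1 (suc j) (λ ()))) (trans (product-const n) (1^ n)))) (*-identityʳ _)
    product-single v (suc i) v≈1 = trans (*-congʳ (v≈1 zero (λ ()))) (trans (*-identityˡ _)
      (product-single (v ∘ suc) i (λ j j≢i → v≈1 (suc j) (j≢i ∘ Fin.suc-injective))))

    -- Guarded factors with default 1. They let a product over all of the field be separated into
    -- its part over the units and its part at zero, without an enumeration of the units.
    unlessZero ifZero : Carrier → Carrier → Carrier
    unlessZero a b with a ≈? 0#
    ... | yes _ = 1#
    ... | no  _ = b
    ifZero a b with a ≈? 0#
    ... | yes _ = b
    ... | no  _ = 1#

    unlessZero-cong : ∀ {a a′ b b′} → a ≈ a′ → b ≈ b′ → unlessZero a b ≈ unlessZero a′ b′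
    unlessZero-cong {a} {a′} a≈a′ b≈b′ with a ≈? 0# | a′ ≈? 0#
    ... | yes p | yes _ = refl
    ... | yes p | no ¬p = ⊥-elim (¬p (trans (sym a≈a′) p))
    ... | no ¬p | yes p = ⊥-elim (¬p (trans a≈a′ p))
    ... | no _  | no _  = b≈b′

    unlessZero-nonzero : ∀ a → ¬ (unlessZero a a ≈ 0#)
    unlessZero-nonzero a with a ≈? 0#
    ... | yes _ = 0≉1 ∘ sym
    ... | no ¬p = ¬p

    unlessZero-* : ∀ {b} → ¬ (b ≈ 0#) → ∀ a → unlessZero (b * a) (b * a) ≈ unlessZero a b * unlessZero a a
    unlessZero-* {b} b≉0 a with b * a ≈? 0# | a ≈? 0#
    ... | yes _ | yes _ = sym (*-identityˡ 1#)
    ... | yes p | no ¬p = ⊥-elim (¬p (a*b≈0⇒b≈0 b≉0 p))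
    ... | no ¬p | yes p = ⊥-elim (¬p (trans (*-congˡ p) (zeroʳ b)))
    ... | no _  | no _  = refl

    split : ∀ b a → b ≈ unlessZero a b * ifZero a b
    split b a with a ≈? 0#
    ... | yes _ = sym (*-identityˡ b)
    ... | no  _ = sym (*-identityʳ b)

    ifZero-0 : ∀ a b → a ≈ 0# → ifZero a b ≈ b
    ifZero-0 a b p with a ≈? 0#
    ... | yes _ = refl
    ... | no ¬p = ⊥-elim (¬p p)

    ifZero-1 : ∀ a b → ¬ (a ≈ 0#) → ifZero a b ≈ 1#
    ifZero-1 a b ¬p with a ≈? 0#
    ... | yes p = ⊥-elim (¬p p)
    ... | no _  = refl

    multiplication : ∀ {b} → ¬ (b ≈ 0#) → Perm.Permutation q q
    multiplication {b} b≉0 = Perm.permutation (λ i → from (b * to i)) (λ i → from (b ⁻¹ * to i))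
      (λ i → ≡.trans (from-cong (trans (*-congˡ (strictlyInverseˡ _))
         (trans (sym (*-assoc b (b ⁻¹) (to i))) (trans (*-congʳ (⁻¹-inverse b b≉0)) (*-identityˡ _))))) (strictlyInverseʳ i))
      (λ i → ≡.trans (from-cong (trans (*-congˡ (strictlyInverseˡ _)) (⁻¹-cancelˡ b≉0 (to i)))) (strictlyInverseʳ i))

  -- Multiplication by b permutes the nonzero elements, so b^{q-1} times their
  -- product is their product; the zero element contributes the last factor b.
  fermat : ∀ b → b ^ q ≈ b
  fermat b with b ≈? 0#
  ... | yes p = trans (^-congˡ q p) (trans (0^ q (ℕ.≤-trans (s≤s z≤n) 2≤q)) (sym p))
  ... | no b≉0 = begin
    b ^ q                                            ≈⟨ product-const q ⟨
    product {q} (λ i → b)                                ≈⟨ product-cong {q} (λ i → split b (to i)) ⟩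
    product {q} (λ i → unlessZero (to i) b * ifZero (to i) b)  ≈⟨ product-distrib-* {q} (λ i → unlessZero (to i) b) (λ i → ifZero (to i) b) ⟩
    product {q} (λ i → unlessZero (to i) b) * product {q} (λ i → ifZero (to i) b)
      ≈⟨ *-cong nonzeroPart (trans (product-single {q} _ (from 0#) λ j j≢0 → ifZero-1 (to j) b
           λ p → j≢0 (≡.trans (≡.sym (strictlyInverseʳ j)) (from-cong p)))
           (ifZero-0 _ b (strictlyInverseˡ 0#))) ⟩
    1# * b                                           ≈⟨ *-identityˡ b ⟩
    b                                                ∎
    where
    units : Fin q → Carrier
    units i = unlessZero (to i) (to i)
    nonzeroPart : product {q} (λ i → unlessZero (to i) b) ≈ 1#
    nonzeroPart = *-cancelˡ (product-nonzero units (λ i → unlessZero-nonzero (to i))) (begin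
      product units * product {q} (λ i → unlessZero (to i) b)  ≈⟨ *-comm _ _ ⟩
      product {q} (λ i → unlessZero (to i) b) * product units  ≈⟨ product-distrib-* {q} (λ i → unlessZero (to i) b) units ⟨
      product {q} (λ i → unlessZero (to i) b * units i)        ≈⟨ product-cong {q} (λ i → sym (trans
                                                                (unlessZero-cong (strictlyInverseˡ _) (strictlyInverseˡ _)) (unlessZero-* b≉0 (to i)))) ⟩
      product {q} (λ i → units (from (b * to i)))              ≈⟨ product-permute units (multiplication b≉0) ⟨
      product units                                        ≈⟨ *-identityʳ _ ⟨
      product units * 1#                                   ∎)

-- Real numbers: order, excluded middle and the Archimedean property from completeness.

module RealProperties (ℝ : CompleteOrderedField) where
  open CompleteOrderedField ℝ hiding (zero)
  open DecTotalOrder decTotalOrder public using (_≤?_; antisym; poset) renaming (refl to ≤-refl)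
  open DecTotalOrderProperties decTotalOrder public
    using (<-respˡ-≈; <-respʳ-≈; <-trans; <⇒≱; ≰⇒>)
  open FieldProperties 𝔽 public
  open IntegerCoefficients commutativeRing
  module ≤-Reasoning = PartialOrderReasoning poset
  open ≤-Reasoning

  open Max (DecTotalOrder.totalOrder decTotalOrder) public using (x≤x⊔y; x≤y⊔x)

  <⇒≤ : ∀ {a b} → a < b → a ≤ b
  <⇒≤ = proj₁

  ≤-<-trans : ∀ {a b c} → a ≤ b → b < c → a < c
  ≤-<-trans = NonStrictToStrict.≤-<-trans _≈_ _≤_ ≤-trans antisym ≤-respˡ

  <-≤-trans : ∀ {a b c} → a < b → b ≤ c → a < c
  <-≤-trans = NonStrictToStrict.<-≤-trans _≈_ _≤_ sym ≤-trans antisym ≤-respʳ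

  0<1 : 0# < 1#
  0<1 = 0≤1 , 0≉1

  -- The set {0} ∪ {1 : P} has a supremum, and comparing it with 0 decides P.
  excluded-middle : (P : Set) → Dec P
  excluded-middle P with complete {P ⊎ ⊤} indicator (inj₂ tt) (1# , below)
    where
    indicator : P ⊎ ⊤ → Carrier
    indicator (inj₁ _) = 1#
    indicator (inj₂ _) = 0#
    below : IsUpperBound indicator 1#
    below (inj₁ _) = ≤-refl
    below (inj₂ _) = 0≤1
  ... | s , upper , approached with s ≤? 0#
  ... | yes s≤0 = no λ p → <⇒≱ 0<1 (≤-trans (upper (inj₁ p)) s≤0)
  ... | no  s≰0 with approached 0# (≰⇒> s≰0)
  ... | inj₁ p , _   = yes p
  ... | inj₂ _ , 0<0 = ⊥-elim (<⇒≱ 0<0 ≤-refl)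

  *-monoʳ-≤ : ∀ {a b c} → 0# ≤ c → a ≤ b → c * a ≤ c * b
  *-monoʳ-≤ {a} {b} {c} 0≤c a≤b = begin
    c * a                  ≈⟨ +-identityʳ _ ⟨
    c * a + 0#             ≤⟨ +-monoʳ-≤ (c * a) (*-nonneg 0≤c (≤-respˡ (-‿inverseˡ a) (+-monoʳ-≤ (- a) a≤b))) ⟩
    c * a + c * (- a + b)  ≈⟨ solve 3 (λ a b c → c :* a :+ c :* ((:- a) :+ b) := c :* b) refl a b c ⟩
    c * b                  ∎

  *-monoˡ-≤ : ∀ {a b c} → 0# ≤ c → a ≤ b → a * c ≤ b * c
  *-monoˡ-≤ {a} {b} {c} 0≤c a≤b = ≤-respˡ (*-comm c a) (≤-respʳ (*-comm c b) (*-monoʳ-≤ 0≤c a≤b))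

  *-mono-≤ : ∀ {a b c d} → 0# ≤ a → 0# ≤ d → a ≤ b → c ≤ d → a * c ≤ b * d
  *-mono-≤ 0≤a 0≤d a≤b c≤d = ≤-trans (*-monoʳ-≤ 0≤a c≤d) (*-monoˡ-≤ 0≤d a≤b)

  0<⇒≉0 : ∀ {a} → 0# < a → ¬ (a ≈ 0#)
  0<⇒≉0 (_ , 0≉a) a≈0 = 0≉a (sym a≈0)

  *-monoʳ-< : ∀ {a b c} → 0# < c → a < b → c * a < c * b
  *-monoʳ-< 0<c (a≤b , a≉b) = *-monoʳ-≤ (<⇒≤ 0<c) a≤b , a≉b ∘ *-cancelˡ (0<⇒≉0 0<c)

  *-cancelʳ-≤ : ∀ {a b c} → 0# < c → c * a ≤ c * b → a ≤ b
  *-cancelʳ-≤ {a} {b} 0<c p with a ≤? b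
  ... | yes q = q
  ... | no ¬q = ⊥-elim (<⇒≱ (*-monoʳ-< 0<c (≰⇒> ¬q)) p)

  *-cancelʳ-< : ∀ {a b c} → 0# ≤ c → c * a < c * b → a < b
  *-cancelʳ-< {a} {b} 0≤c p with b ≤? a
  ... | yes q = ⊥-elim (<⇒≱ p (*-monoʳ-≤ 0≤c q))
  ... | no ¬q = ≰⇒> ¬q

  *-pos : ∀ {a b} → 0# < a → 0# < b → 0# < a * b
  *-pos {a} 0<a 0<b = <-respˡ-≈ (zeroʳ a) (*-monoʳ-< 0<a 0<b)

  0≤∧≉⇒0< : ∀ {a} → 0# ≤ a → ¬ (a ≈ 0#) → 0# < a
  0≤∧≉⇒0< 0≤a a≉0 = 0≤a , a≉0 ∘ sym

  ⁻¹-pos : ∀ {a} → 0# < a → 0# < a ⁻¹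
  ⁻¹-pos {a} 0<a = *-cancelʳ-< (<⇒≤ 0<a)
    (<-respˡ-≈ (sym (zeroʳ a)) (<-respʳ-≈ (sym (⁻¹-inverse a (0<⇒≉0 0<a))) 0<1))

  ^-nonneg : ∀ {a} → 0# ≤ a → ∀ n → 0# ≤ a ^ n
  ^-nonneg 0≤a zero    = 0≤1
  ^-nonneg 0≤a (suc n) = *-nonneg 0≤a (^-nonneg 0≤a n)

  ^-pos : ∀ {a} → 0# < a → ∀ n → 0# < a ^ n
  ^-pos 0<a n = 0≤∧≉⇒0< (^-nonneg (<⇒≤ 0<a) n) (^-nonzero (0<⇒≉0 0<a) n)

  ^-≤1 : ∀ {a} → 0# ≤ a → a ≤ 1# → ∀ n → a ^ n ≤ 1#
  ^-≤1 0≤a a≤1 zero    = ≤-refl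
  ^-≤1 0≤a a≤1 (suc n) = a≤1∧b≤1⇒ab≤1 a≤1 (^-nonneg 0≤a n) (^-≤1 0≤a a≤1 n)

  ^-≤ : ∀ {a} → 0# ≤ a → a ≤ 1# → ∀ n → 1 ℕ.≤ n → a ^ n ≤ a
  ^-≤ {a} 0≤a a≤1 (suc n) _ = ≤-respʳ (*-identityʳ a) (*-monoʳ-≤ 0≤a (^-≤1 0≤a a≤1 n))

  ^-mono-≤ : ∀ {a b} → 0# ≤ a → a ≤ b → ∀ n → a ^ n ≤ b ^ n
  ^-mono-≤ 0≤a a≤b zero    = ≤-refl
  ^-mono-≤ 0≤a a≤b (suc n) = *-mono-≤ 0≤a (^-nonneg (≤-trans 0≤a a≤b) n) a≤b (^-mono-≤ 0≤a a≤b n)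

  1≤^ : ∀ {a} → 1# ≤ a → ∀ n → 1# ≤ a ^ n
  1≤^ 1≤a zero    = ≤-refl
  1≤^ 1≤a (suc n) = ≤-trans 1≤a (≤-respʳ (*-comm _ _) (1≤a⇒b≤ab (1≤^ 1≤a n) (≤-trans 0≤1 1≤a)))

  ^-monoʳ-≤ : ∀ {a} → 1# ≤ a → ∀ {m n} → m ℕ.≤ n → a ^ m ≤ a ^ n
  ^-monoʳ-≤ {a} 1≤a {n = n} z≤n = 1≤^ 1≤a n
  ^-monoʳ-≤ {a} 1≤a (s≤s m≤n) = *-monoʳ-≤ (≤-trans 0≤1 1≤a) (^-monoʳ-≤ 1≤a m≤n)

  -- Serves for |1| = |-1|: in (1 + x)(x - 1) = 0 the first factor is positive.
  x*x≈1⇒x≈1 : ∀ {x} → 0# ≤ x → x * x ≈ 1# → x ≈ 1#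
  x*x≈1⇒x≈1 {x} 0≤x x²≈1 = a-b≈0⇒a≈b (a*b≈0⇒b≈0 1+x≉0 (begin-equality
    (1# + x) * (x - 1#)             ≈⟨ solve 2 (λ o x → (o :+ x) :* (x :- o) := x :* x :- o :* o) refl 1# x ⟩
    x * x - 1# * 1#                 ≈⟨ +-cong x²≈1 (-‿cong (*-identityˡ 1#)) ⟩
    1# - 1#                         ≈⟨ -‿inverseʳ 1# ⟩
    0#                              ∎))
    where
    1+x≉0 : ¬ (1# + x ≈ 0#)
    1+x≉0 p = <⇒≱ 0<1 (≤-respʳ p (≤-respˡ (+-identityʳ 1#) (+-monoʳ-≤ 1# 0≤x)))

  1<fromℕ : ∀ {n} → 2 ℕ.≤ n → 1# < fromℕ n
  1<fromℕ {suc (suc n)} (s≤s (s≤s _)) = 1≤fromℕ (suc n) , λ p → <⇒≱ 0<1 (begin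
    1#                           ≤⟨ 1≤fromℕ n ⟩
    fromℕ (suc n)                ≈⟨ solve 2 (λ o x → x := (o :+ x) :- o) refl 1# (fromℕ (suc n)) ⟩
    1# + fromℕ (suc n) - 1#      ≈⟨ a≈b⇒a-b≈0 (sym p) ⟩
    0#                           ∎)

  tendsToZero : ∀ {a} → (∀ n → 0# ≤ a n) → (∀ ε → 0# < ε → ∃[ N ] ∀ n → N ℕ.≤ n → a n < ε) → TendsToZero a
  tendsToZero {a} 0≤a small ε 0<ε with small ε 0<ε
  ... | N , p = N , λ n N≤n → <-≤-trans -ε<0 (0≤a n) , p n N≤n
    where
    -ε<0 : - ε < 0#
    -ε<0 = ≰⇒> λ 0≤-ε → <⇒≱ 0<ε (begin
      ε          ≈⟨ +-identityʳ ε ⟨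
      ε + 0#     ≤⟨ +-monoʳ-≤ ε 0≤-ε ⟩
      ε - ε      ≈⟨ -‿inverseʳ ε ⟩
      0#         ∎)

  -- Only finitely many terms can exceed b, and M is the largest of them and b. Keeping `b ≤ M`
  -- makes M nonnegative when b is.
  eventuallyBounded⇒bounded : ∀ (a : ℕ → Carrier) N b → (∀ n → N ℕ.≤ n → a n ≤ b) →
                              ∃[ M ] b ≤ M × (∀ n → a n ≤ M)
  eventuallyBounded⇒bounded a zero    b p = b , ≤-refl , λ n → p n z≤n
  eventuallyBounded⇒bounded a (suc N) b p with eventuallyBounded⇒bounded (a ∘ suc) N b (λ n N≤n → p (suc n) (s≤s N≤n))
  ... | M , b≤M , q with ≤-total M (a 0)
  ... | inj₁ M≤a = a 0 , ≤-trans b≤M M≤a , λ { zero → ≤-refl ; (suc n) → ≤-trans (q n) M≤a }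
  ... | inj₂ a≤M = M , b≤M , λ { zero → a≤M ; (suc n) → q n }

  module Powers {a} (1<a : 1# < a) where

    0<a : 0# < a
    0<a = <-trans 0<1 1<a

    -- Otherwise the powers have a supremum s. Since s/a < s, some power exceeds s/a, and then the
    -- next power exceeds s.
    ^-unbounded : ∀ b → ∃[ N ] b < a ^ N
    ^-unbounded b with excluded-middle (∃[ N ] b < a ^ N)
    ... | yes p = p
    ... | no ¬p with complete (a ^_) 0 (b , λ N → [ N ]≤)
      where
      [_]≤ : ∀ N → a ^ N ≤ b
      [ N ]≤ with a ^ N ≤? b
      ... | yes q = q
      ... | no ¬q = ⊥-elim (¬p (N , ≰⇒> ¬q))
    ... | s , upper , approached with approached (a ⁻¹ * s) (*-cancelʳ-< (<⇒≤ 0<a) (<-respˡ-≈ (sym (⁻¹-cancelʳ (0<⇒≉0 0<a) s)) s<as))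
      where
      s<as : s < a * s
      s<as = <-respˡ-≈ (*-identityʳ s) (<-respʳ-≈ (*-comm s a) (*-monoʳ-< (<-≤-trans 0<1 (upper 0)) 1<a))
    ... | N , s<a^N = ⊥-elim (<⇒≱ s<a^[1+N] (upper (suc N)))
      where
      s<a^[1+N] : s < a ^ suc N
      s<a^[1+N] = <-respˡ-≈ (⁻¹-cancelʳ (0<⇒≉0 0<a) s) (*-monoʳ-< 0<a s<a^N)

    archimedean : ∀ b {ε} → 0# < ε → ∃[ N ] ∀ n → N ℕ.≤ n → b < a ^ n * ε
    archimedean b {ε} 0<ε with ^-unbounded (ε ⁻¹ * b)
    ... | N , p = N , λ n N≤n → begin-strict
      b                  ≈⟨ ⁻¹-cancelʳ (0<⇒≉0 0<ε) b ⟨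
      ε * (ε ⁻¹ * b)     <⟨ *-monoʳ-< 0<ε p ⟩
      ε * a ^ N          ≤⟨ *-monoʳ-≤ (<⇒≤ 0<ε) (^-monoʳ-≤ (<⇒≤ 1<a) N≤n) ⟩
      ε * a ^ n          ≈⟨ *-comm ε (a ^ n) ⟩
      a ^ n * ε          ∎

least : ∀ {P : ℕ → Set} → (∀ n → Dec (P n)) → ∀ n → P n → ∃[ m ] P m × (∀ j → j ℕ.< m → ¬ P j)
least {P} P? n p with P? 0
least P? n       p | yes q = 0 , q , λ _ ()
least P? zero    p | no ¬q = ⊥-elim (¬q p)
least P? (suc n) p | no ¬q with least (P? ∘ suc) n p
... | m , q , below = suc m , q , λ { zero _ → ¬q ; (suc j) (s≤s j<m) → below j j<m }

-- Laurent series: constants, digits and leading terms.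

module LaurentProperties {q} (F : FiniteField q) where
  open LaurentSeries F
  private
    module F where
      open FiniteField F public
      open FiniteFieldProperties F public
      open FieldProperties 𝔽 public

  coeff-at : ∀ z i {j} → i ℤ.- order z ≡ + j → coeff z i ≡ coeffs z j
  coeff-at z i eq with i ℤ.- order z | eq
  ... | + _ | ≡.refl = ≡.refl

  [m+n]-m≡n : ∀ m n → (m ℤ.+ n) ℤ.- m ≡ n
  [m+n]-m≡n m n = ≡.trans (≡.cong (ℤ._- m) (ℤ.+-comm m n)) (≡.trans (ℤ.+-assoc n m (ℤ.- m)) (≡.trans (≡.cong (λ k → n ℤ.+ k) (ℤ.+-inverseʳ m)) (ℤ.+-identityʳ n)))

  coeff-0ᴸ : ∀ i → coeff 0ᴸ i F.≈ F.0#
  coeff-0ᴸ (+ zero)  = F.refl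
  coeff-0ᴸ (+ suc _) = F.refl
  coeff-0ᴸ -[1+ _ ]  = F.refl

  const-+ : ∀ a b → const a +ᴸ const b ≈ᴸ const (a F.+ b)
  const-+ a b (+ zero)  = F.refl
  const-+ a b (+ suc _) = F.+-identityˡ F.0#
  const-+ a b -[1+ _ ]  = F.refl

  const-cong : ∀ {a b} → a F.≈ b → const a ≈ᴸ const b
  const-cong a≈b (+ zero)  = a≈b
  const-cong a≈b (+ suc _) = F.refl
  const-cong a≈b -[1+ _ ]  = F.refl

  coeffs-const-* : ∀ a (w : ℕ → F.Carrier) n →
    F.sum {suc n} (λ j → coeffs (const a) (toℕ j) F.* w (n ∸ toℕ j)) F.≈ a F.* w n
  coeffs-const-* a w n = F.trans (F.+-congˡ (F.sum-zero n (λ j → F.zeroˡ _))) (F.+-identityʳ _)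

  const-* : ∀ a b → const a *ᴸ const b ≈ᴸ const (a F.* b)
  const-* a b (+ zero)  = coeffs-const-* a (coeffs (const b)) 0
  const-* a b (+ suc n) = F.trans (coeffs-const-* a (coeffs (const b)) (suc (n ℕ.+ 0))) (F.zeroʳ a)
  const-* a b -[1+ _ ]  = F.refl

  -- For integral t this is (t - t₀)/x, where t₀ is the constant coefficient.
  shiftDown : Laurent → Laurent
  shiftDown t = x^ 0ℤ · λ j → coeff t (+ suc j)

  digit-expansion : ∀ t → (∀ n → coeff t -[1+ n ] F.≈ F.0#) →
                    t ≈ᴸ const (coeff t 0ℤ) +ᴸ X *ᴸ shiftDown t
  digit-expansion t t≈0 (+ zero)  = F.sym (F.+-identityʳ _)
  digit-expansion t t≈0 (+ suc n) = F.sym (F.trans (F.+-identityˡ _)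
    (F.trans (coeffs-const-* F.1# (coeffs (shiftDown t)) (n ℕ.+ 0)) (F.trans (F.*-identityˡ _)
      (F.reflexive (≡.cong (λ m → coeff t (+ suc m)) (ℕ.+-identityʳ n))))))
  digit-expansion t t≈0 -[1+ n ]  = t≈0 n

  -- Single coefficients can be tested, but the vanishing of all of them needs excluded middle. The
  -- offset j is there because `order z` is only a lower bound: the first stored coefficients may
  -- vanish.
  zero⊎leading : (∀ (P : Set) → Dec P) → ∀ z →
    (z ≈ᴸ 0ᴸ) ⊎ (∃[ j ] HasLeadingIndex z (order z ℤ.+ + j))
  zero⊎leading em z with em (∃[ j ] ¬ (coeffs z j F.≈ F.0#))
  ... | no  none = inj₁ λ i → F.trans (vanishes i) (F.sym (coeff-0ᴸ i))
    where
    vanishes : ∀ i → coeff z i F.≈ F.0#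
    vanishes i with i ℤ.- order z
    ... | -[1+ _ ] = F.refl
    ... | + j with coeffs z j F.≈? F.0#
    ... | yes p = p
    ... | no ¬p = ⊥-elim (none (j , ¬p))
  ... | yes (n , p) with least (λ j → em (¬ (coeffs z j F.≈ F.0#))) n p
  ... | j , q , below = inj₂ (j , vanishes , λ r → q (F.trans (F.reflexive (≡.sym (coeff-at z (order z ℤ.+ + j) ([m+n]-m≡n (order z) (+ j))))) r))
    where
    vanishes : ∀ i → i ℤ.< order z ℤ.+ + j → coeff z i F.≈ F.0#
    vanishes i i<o+j with i ℤ.- order z in eq
    ... | -[1+ _ ] = F.refl
    ... | + m with coeffs z m F.≈? F.0#
    ... | yes p = p
    ... | no ¬p = ⊥-elim (below m (ℤ.drop‿+<+ (≡.subst₂ ℤ._<_ eq ([m+n]-m≡n (order z) (+ j))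
                    (ℤ.+-monoˡ-< (ℤ.- order z) i<o+j))) ¬p)

-- The valued field: ultrametric estimates, the embedded copy of the finite field, Frobenius,
-- digits.

module ValuedFieldProperties (ℝ : CompleteOrderedField) {q} (F : FiniteField q) (C : CompletedAlgebraicClosure ℝ F) where
  private
    module ℝ where
      open CompleteOrderedField ℝ public
      open RealProperties ℝ public
    module F where
      open FiniteField F public
      open FiniteFieldProperties F public
      open FieldProperties 𝔽 public
  open LaurentSeries F
  open LaurentProperties F
  open CompletedAlgebraicClosure C hiding (zero)
  open FieldProperties 𝔽
  open IntegerCoefficients commutativeRing
  private module ι-homo = IsRingHomomorphism ι-homo
  open SetoidReasoning setoid

  1≤q : 1 ℕ.≤ q
  1≤q = ℕ.≤-trans (s≤s z≤n) F.2≤q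

  ∣∣-pos : ∀ {a} → ¬ (a ≈ 0#) → ℝ.0# ℝ.< ∣ a ∣
  ∣∣-pos {a} a≉0 = ℝ.0≤∧≉⇒0< (∣∣-nonneg a) (a≉0 ∘ ∣∣-definite a)

  ∣∣≈0 : ∀ {a} → a ≈ 0# → ∣ a ∣ ℝ.≈ ℝ.0#
  ∣∣≈0 a≈0 = ℝ.trans (∣∣-cong a≈0) ∣0∣

  _≈0? : ∀ a → Dec (a ≈ 0#)
  a ≈0? = ℝ.excluded-middle (a ≈ 0#)

  ∣∣<all⇒≈0 : ∀ {a} → (∀ ε → ℝ.0# ℝ.< ε → ∣ a ∣ ℝ.< ε) → a ≈ 0#
  ∣∣<all⇒≈0 {a} small with a ≈0?
  ... | yes p = p
  ... | no ¬p = ⊥-elim (ℝ.<⇒≱ (small ∣ a ∣ (∣∣-pos ¬p)) ℝ.≤-refl)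

  ∣1∣ : ∣ 1# ∣ ℝ.≈ ℝ.1#
  ∣1∣ = ℝ.*-cancelˡ (λ p → 0≉1 (sym (∣∣-definite 1# p)))
    (ℝ.trans (ℝ.sym (∣∣-* 1# 1#)) (ℝ.trans (∣∣-cong (*-identityˡ 1#)) (ℝ.sym (ℝ.*-identityʳ _))))

  ∣-∣ : ∀ a → ∣ - a ∣ ℝ.≈ ∣ a ∣
  ∣-∣ a = ℝ.trans (∣∣-cong (trans (-‿cong (sym (*-identityˡ a))) (solve 2 (λ o a → :- (o :* a) := (:- o) :* a) refl 1# a)))
    (ℝ.trans (∣∣-* (- 1#) a) (ℝ.trans (ℝ.*-congʳ ∣-1∣) (ℝ.*-identityˡ _)))
    where
    ∣-1∣ : ∣ - 1# ∣ ℝ.≈ ℝ.1#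
    ∣-1∣ = ℝ.x*x≈1⇒x≈1 (∣∣-nonneg _) (ℝ.trans (ℝ.sym (∣∣-* _ _))
      (ℝ.trans (∣∣-cong (trans (solve 1 (λ o → (:- o) :* (:- o) := o :* o) refl 1#) (*-identityˡ 1#))) ∣1∣))

  ∣+∣-≤ : ∀ {a b M} → ∣ a ∣ ℝ.≤ M → ∣ b ∣ ℝ.≤ M → ∣ a + b ∣ ℝ.≤ M
  ∣+∣-≤ {a} {b} p q = ℝ.≤-trans (∣∣-+ a b) (ℝ.⊔-lub p q)

  ∣-∣-≤ : ∀ {a b M} → ∣ a ∣ ℝ.≤ M → ∣ b ∣ ℝ.≤ M → ∣ a - b ∣ ℝ.≤ M
  ∣-∣-≤ {a} {b} p q = ∣+∣-≤ p (ℝ.≤-respˡ (ℝ.sym (∣-∣ b)) q)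

  -- The ultrametric maximum as a case distinction: any bound, strict or weighted, can then be
  -- carried along the dominating term.
  ∣-∣-selective : ∀ a b → (∣ a - b ∣ ℝ.≤ ∣ a ∣) ⊎ (∣ a - b ∣ ℝ.≤ ∣ b ∣)
  ∣-∣-selective a b with ℝ.≤-total ∣ a ∣ ∣ b ∣
  ... | inj₁ p = inj₂ (∣-∣-≤ p ℝ.≤-refl)
  ... | inj₂ p = inj₁ (∣-∣-≤ ℝ.≤-refl p)

  ∣-∣-< : ∀ {a b ε} → ∣ a ∣ ℝ.< ε → ∣ b ∣ ℝ.< ε → ∣ a - b ∣ ℝ.< ε
  ∣-∣-< {a} {b} p q with ∣-∣-selective a b
  ... | inj₁ r = ℝ.≤-<-trans r p
  ... | inj₂ r = ℝ.≤-<-trans r q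

  ∣a-b∣≈∣b-a∣ : ∀ a b → ∣ a - b ∣ ℝ.≈ ∣ b - a ∣
  ∣a-b∣≈∣b-a∣ a b = ℝ.trans (∣∣-cong (solve 2 (λ a b → a :- b := :- (b :- a)) refl a b)) (∣-∣ (b - a))

  ∣-∣-trans-< : ∀ {a b c ε} → ∣ a - b ∣ ℝ.< ε → ∣ b - c ∣ ℝ.< ε → ∣ a - c ∣ ℝ.< ε
  ∣-∣-trans-< {a} {b} {c} p q = ℝ.<-respˡ-≈ (∣∣-cong (solve 3 (λ a b c → (a :- b) :- (c :- b) := a :- c) refl a b c))
    (∣-∣-< p (ℝ.<-respˡ-≈ (∣a-b∣≈∣b-a∣ b c) q))

  ∣a-b∣<ε∧∣b∣<ε⇒∣a∣<ε : ∀ {a b ε} → ∣ a - b ∣ ℝ.< ε → ∣ b ∣ ℝ.< ε → ∣ a ∣ ℝ.< ε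
  ∣a-b∣<ε∧∣b∣<ε⇒∣a∣<ε {a} {b} p q = ℝ.<-respˡ-≈ (∣∣-cong (solve 2 (λ a b → (a :- b) :- (:- b) := a) refl a b))
    (∣-∣-< p (ℝ.<-respˡ-≈ (ℝ.sym (∣-∣ b)) q))

  -- A bound M survives a limit because ε may be taken to be the offending |a| itself.
  ∣∣-limit-≤ : ∀ {a M} → ℝ.0# ℝ.≤ M → (∀ ε → ℝ.0# ℝ.< ε → ∃[ b ] (∣ a - b ∣ ℝ.< ε) × (∣ b ∣ ℝ.≤ M)) → ∣ a ∣ ℝ.≤ M
  ∣∣-limit-≤ {a} {M} 0≤M approx with ∣ a ∣ ℝ.≤? M
  ... | yes p = p
  ... | no ¬p with approx ∣ a ∣ (ℝ.≤-<-trans 0≤M (ℝ.≰⇒> ¬p))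
  ... | b , p , q = ⊥-elim (ℝ.<⇒≱ (∣a-b∣<ε∧∣b∣<ε⇒∣a∣<ε p (ℝ.≤-<-trans q (ℝ.≰⇒> ¬p))) ℝ.≤-refl)

  ∣^∣ : ∀ a n → ∣ a ^ n ∣ ℝ.≈ ∣ a ∣ ℝ.^ n
  ∣^∣ a zero    = ∣1∣
  ∣^∣ a (suc n) = ℝ.trans (∣∣-* a (a ^ n)) (ℝ.*-congˡ (∣^∣ a n))

  ∣*∣-≤ : ∀ {a b M N} → ∣ a ∣ ℝ.≤ M → ∣ b ∣ ℝ.≤ N → ∣ a * b ∣ ℝ.≤ M ℝ.* N
  ∣*∣-≤ {a} {b} p q = ℝ.≤-respˡ (ℝ.sym (∣∣-* a b)) (ℝ.*-mono-≤ (∣∣-nonneg a) (ℝ.≤-trans (∣∣-nonneg b) q) p q)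

  ∣a*b∣≤∣b∣ : ∀ {a} b → ∣ a ∣ ℝ.≤ ℝ.1# → ∣ a * b ∣ ℝ.≤ ∣ b ∣
  ∣a*b∣≤∣b∣ b p = ℝ.≤-respʳ (ℝ.*-identityˡ _) (∣*∣-≤ p ℝ.≤-refl)

  ∣^∣≤1 : ∀ {a} n → ∣ a ∣ ℝ.≤ ℝ.1# → ∣ a ^ n ∣ ℝ.≤ ℝ.1#
  ∣^∣≤1 {a} n p = ℝ.≤-respˡ (ℝ.sym (∣^∣ a n)) (ℝ.^-≤1 (∣∣-nonneg a) p n)

  ∣sum∣≤ : ∀ {M} → ℝ.0# ℝ.≤ M → ∀ {n} (v : Fin n → Carrier) → (∀ i → ∣ v i ∣ ℝ.≤ M) → ∣ sum v ∣ ℝ.≤ M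
  ∣sum∣≤ 0≤M {zero}  v v≤M = ℝ.≤-respˡ (ℝ.sym ∣0∣) 0≤M
  ∣sum∣≤ 0≤M {suc n} v v≤M = ∣+∣-≤ (v≤M zero) (∣sum∣≤ 0≤M (v ∘ suc) (v≤M ∘ suc))

  Q : ℝ.Carrier
  Q = ℝ.fromℕ q

  1<Q : ℝ.1# ℝ.< Q
  1<Q = ℝ.1<fromℕ F.2≤q

  0<Q : ℝ.0# ℝ.< Q
  0<Q = ℝ.<-trans ℝ.0<1 1<Q

  x : Carrier
  x = ι X

  ∣x∣≈Q⁻¹ : ∣ x ∣ ℝ.≈ Q ℝ.⁻¹
  ∣x∣≈Q⁻¹ = ℝ.trans (∣∣-extends X 1ℤ (below , F.0≉1 ∘ F.sym)) (ℝ.*-identityʳ _)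
    where
    below : ∀ i → i ℤ.< 1ℤ → coeff X i F.≈ F.0#
    below (+ zero)  _ = F.refl
    below (+ suc _) (ℤ.+<+ (s≤s ()))
    below -[1+ n ]  _ = F.refl

  ∣x∣*Q≈1 : ∣ x ∣ ℝ.* Q ℝ.≈ ℝ.1#
  ∣x∣*Q≈1 = ℝ.trans (ℝ.*-comm _ _) (ℝ.trans (ℝ.*-congˡ ∣x∣≈Q⁻¹) (ℝ.⁻¹-inverse Q (ℝ.0<⇒≉0 0<Q)))

  0<∣x∣ : ℝ.0# ℝ.< ∣ x ∣
  0<∣x∣ = ℝ.<-respʳ-≈ (ℝ.sym ∣x∣≈Q⁻¹) (ℝ.⁻¹-pos 0<Q)

  x≉0 : ¬ (x ≈ 0#)
  x≉0 p = ℝ.0<⇒≉0 0<∣x∣ (∣∣≈0 p)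

  ∣x∣≤1 : ∣ x ∣ ℝ.≤ ℝ.1#
  ∣x∣≤1 = ℝ.≤-respˡ (ℝ.sym ∣x∣≈Q⁻¹) (ℝ.1≤a⇒a⁻¹≤1 (ℝ.<⇒≤ 1<Q))

  ∣x∣<1 : ∣ x ∣ ℝ.< ℝ.1#
  ∣x∣<1 = ∣x∣≤1 , λ p → proj₂ 1<Q (ℝ.trans (ℝ.sym ∣x∣*Q≈1) (ℝ.trans (ℝ.*-congʳ p) (ℝ.*-identityˡ Q)))

  Q^*∣x^∣≈1 : ∀ n → Q ℝ.^ n ℝ.* ∣ x ^ n ∣ ℝ.≈ ℝ.1#
  Q^*∣x^∣≈1 n = ℝ.trans (ℝ.*-congˡ (∣^∣ x n)) (ℝ.trans (ℝ.sym (ℝ.^-distrib-* Q ∣ x ∣ n))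
    (ℝ.trans (ℝ.^-congˡ n (ℝ.trans (ℝ.*-comm _ _) ∣x∣*Q≈1)) (ℝ.1^ n)))

  τ : F.Carrier → Carrier
  τ a = ι (const a)

  τ-cong : ∀ {a b} → a F.≈ b → τ a ≈ τ b
  τ-cong a≈b = ι-homo.⟦⟧-cong (const-cong a≈b)

  τ-+ : ∀ a b → τ (a F.+ b) ≈ τ a + τ b
  τ-+ a b = trans (sym (ι-homo.⟦⟧-cong (const-+ a b))) (ι-homo.+-homo _ _)

  τ-* : ∀ a b → τ (a F.* b) ≈ τ a * τ b
  τ-* a b = trans (sym (ι-homo.⟦⟧-cong (const-* a b))) (ι-homo.*-homo _ _)

  τ-1 : τ F.1# ≈ 1#
  τ-1 = ι-homo.1#-homo

  τ-0 : τ F.0# ≈ 0#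
  τ-0 = ι-homo.0#-homo

  τ-^ : ∀ a n → τ (a F.^ n) ≈ τ a ^ n
  τ-^ a zero    = τ-1
  τ-^ a (suc n) = trans (τ-* a (a F.^ n)) (*-congˡ (τ-^ a n))

  τ-fermat : ∀ a → τ a ^ q ≈ τ a
  τ-fermat a = trans (sym (τ-^ a q)) (τ-cong (F.fermat a))

  τ-injective : ∀ {a b} → τ a ≈ τ b → a F.≈ b
  τ-injective {a} {b} eq with (a F.- b) F.≈? F.0#
  ... | yes p = F.a-b≈0⇒a≈b p
  ... | no ¬p = ⊥-elim (0≉1 (begin
    0#                              ≈⟨ zeroˡ _ ⟨
    0# * τ ((a F.- b) F.⁻¹)          ≈⟨ *-congʳ difference ⟨
    τ (a F.- b) * τ ((a F.- b) F.⁻¹) ≈⟨ τ-* _ _ ⟨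
    τ ((a F.- b) F.* (a F.- b) F.⁻¹) ≈⟨ τ-cong (F.⁻¹-inverse _ ¬p) ⟩
    τ F.1#                          ≈⟨ τ-1 ⟩
    1#                              ∎))
    where
    difference : τ (a F.- b) ≈ 0#
    difference = begin
      τ (a F.- b)               ≈⟨ solve 2 (λ d b → d := (d :+ b) :- b) refl _ (τ b) ⟩
      τ (a F.- b) + τ b - τ b   ≈⟨ +-congʳ (τ-+ _ _) ⟨
      τ (a F.- b F.+ b) - τ b   ≈⟨ +-congʳ (τ-cong (F.trans (F.+-assoc _ _ _) (F.trans (F.+-congˡ (F.-‿inverseˡ b)) (F.+-identityʳ a)))) ⟩
      τ a - τ b                 ≈⟨ a≈b⇒a-b≈0 eq ⟩
      0#                        ∎

  τᵢ : Fin q → Carrier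
  τᵢ = τ ∘ Inverse.to F.enumeration

  τᵢ-distinct : ∀ {i j} → i ≢ j → ¬ (τᵢ i ≈ τᵢ j)
  τᵢ-distinct i≢j p = i≢j (F.to-injective (τ-injective p))

  product-linear : ∀ y → product (λ i → y - τᵢ i) ≈ y ^ q - y
  product-linear = product-τ F.2≤q τᵢ τᵢ-distinct (λ i → τ-fermat _)

  -- Each `τᵢ i + 1#` is again the image of an element of the finite field, so Fermat's theorem
  -- gives the condition that the root comparison asks for.
  ^q-+ : ∀ a b → (a + b) ^ q ≈ a ^ q + b ^ q
  ^q-+ = frobenius-+ F.2≤q τᵢ τᵢ-distinct (λ i → τ-fermat _)
    (λ i → trans (^-congˡ q (τ+1 i)) (trans (τ-fermat _) (sym (τ+1 i)))) _≈0?
    where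
    τ+1 : ∀ i → τᵢ i + 1# ≈ τ (Inverse.to F.enumeration i F.+ F.1#)
    τ+1 i = sym (trans (τ-+ _ _) (+-congˡ τ-1))

  -- Additivity applied to (a - b) + b, which avoids discussing the sign (-1)^q.
  ^q-- : ∀ a b → (a - b) ^ q ≈ a ^ q - b ^ q
  ^q-- a b = begin
    (a - b) ^ q                  ≈⟨ solve 2 (λ u v → u := (u :+ v) :- v) refl _ (b ^ q) ⟩
    (a - b) ^ q + b ^ q - b ^ q  ≈⟨ +-congʳ (^q-+ (a - b) b) ⟨
    (a - b + b) ^ q - b ^ q      ≈⟨ +-congʳ (^-congˡ q (solve 2 (λ a b → a :- b :+ b := a) refl a b)) ⟩
    a ^ q - b ^ q                ∎

  ^q^suc : ∀ a n → a ^ (q ℕ.^ suc n) ≈ (a ^ (q ℕ.^ n)) ^ q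
  ^q^suc a n = trans (^-congʳ a (ℕ.*-comm q (q ℕ.^ n))) (sym (^-assocʳ a (q ℕ.^ n) q))

  ι-zero : ∀ {z} → z ≈ᴸ 0ᴸ → ι z ≈ 0#
  ι-zero p = trans (ι-homo.⟦⟧-cong p) τ-0

  Q^ℤ-pos : ∀ n → ℝ.0# ℝ.< Q ℝ.^ℤ n
  Q^ℤ-pos (+ n)    = ℝ.^-pos 0<Q n
  Q^ℤ-pos -[1+ n ] = ℝ.^-pos (ℝ.⁻¹-pos 0<Q) (suc n)

  -- A nonzero series has a leading index, so its absolute value is a power of q and therefore
  -- positive.
  ι-nonzero : ∀ {z} → ¬ (z ≈ᴸ 0ᴸ) → ¬ (ι z ≈ 0#)
  ι-nonzero {z} z≉0 p with zero⊎leading ℝ.excluded-middle z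
  ... | inj₁ z≈0 = z≉0 z≈0
  ... | inj₂ (j , leading) = ℝ.0<⇒≉0 (Q^ℤ-pos (ℤ.- (order z ℤ.+ + j))) (ℝ.trans (ℝ.sym (∣∣-extends z _ leading)) (∣∣≈0 p))

  -- A negative leading index would make the absolute value at least q, which exceeds 1.
  ∣ι∣≤1⇒integral : ∀ z → ∣ ι z ∣ ℝ.≤ ℝ.1# → ∀ n → coeff z -[1+ n ] F.≈ F.0#
  ∣ι∣≤1⇒integral z ∣z∣≤1 n with zero⊎leading ℝ.excluded-middle z
  ... | inj₁ z≈0 = F.trans (z≈0 -[1+ n ]) (coeff-0ᴸ -[1+ n ])
  ... | inj₂ (j , leading) with order z ℤ.+ + j
  ... | + m = proj₁ leading -[1+ n ] ℤ.-<+
  ... | -[1+ m ] = ⊥-elim (ℝ.<⇒≱ 1<Q (ℝ.≤-trans (ℝ.≤-respˡ (ℝ.*-identityʳ Q) (ℝ.^-monoʳ-≤ (ℝ.<⇒≤ 1<Q) {1} {suc m} (s≤s z≤n)))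
                     (ℝ.≤-respˡ (∣∣-extends z -[1+ m ] leading) ∣z∣≤1)))

  order≡0⇒∣ι∣≤1 : ∀ w → ∣ ι (x^ 0ℤ · w) ∣ ℝ.≤ ℝ.1#
  order≡0⇒∣ι∣≤1 w with zero⊎leading ℝ.excluded-middle (x^ 0ℤ · w)
  ... | inj₁ z≈0 = ℝ.≤-respˡ (ℝ.sym (∣∣≈0 (ι-zero z≈0))) ℝ.0≤1
  ... | inj₂ (zero  , leading) = ℝ.≤-reflexive (∣∣-extends _ 0ℤ leading)
  ... | inj₂ (suc j , leading) = ℝ.≤-respˡ (ℝ.sym (∣∣-extends _ (+ suc j) leading))
    (ℝ.^-≤1 (ℝ.<⇒≤ (ℝ.⁻¹-pos 0<Q)) (ℝ.1≤a⇒a⁻¹≤1 (ℝ.<⇒≤ 1<Q)) (suc j))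

  digit : ∀ z → ∣ ι z ∣ ℝ.≤ ℝ.1# → ∃[ α ] ∃[ z′ ] (∣ ι z′ ∣ ℝ.≤ ℝ.1#) × (ι z ≈ τ α + x * ι z′)
  digit z ∣z∣≤1 = coeff z 0ℤ , shiftDown z , order≡0⇒∣ι∣≤1 _ ,
    trans (ι-homo.⟦⟧-cong (digit-expansion z (∣ι∣≤1⇒integral z ∣z∣≤1)))
      (trans (ι-homo.+-homo _ _) (+-congˡ (ι-homo.*-homo X (shiftDown z))))

-- Carlitz polynomials: recursion, linearity, product formula and iterated differences.

module CarlitzPolynomials (ℝ : CompleteOrderedField) {q} (F : FiniteField q) (C : CompletedAlgebraicClosure ℝ F) where
  private
    module ℝ where
      open CompleteOrderedField ℝ public
      open RealProperties ℝ public
    module F where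
      open FiniteField F public
      open FiniteFieldProperties F public
  open CompletedAlgebraicClosure C hiding (zero)
  open FieldProperties 𝔽
  open IntegerCoefficients commutativeRing
  open ValuedFieldProperties ℝ F C
  open Carlitz ℝ F C using ([_]; D; poly; e; f; O; ⟦_⟧)
  open SetoidReasoning setoid

  ∣x^n∣<∣x∣ : ∀ {n} → 2 ℕ.≤ n → ∣ x ^ n ∣ ℝ.< ∣ x ∣
  ∣x^n∣<∣x∣ {suc n} (s≤s 1≤n) = ℝ.<-respˡ-≈ (ℝ.sym (∣^∣ x (suc n)))
    (ℝ.≤-<-trans (ℝ.*-monoʳ-≤ (∣∣-nonneg x) (ℝ.^-≤ (∣∣-nonneg x) ∣x∣≤1 n 1≤n))
      (ℝ.<-respʳ-≈ (ℝ.*-identityʳ _) (ℝ.*-monoʳ-< 0<∣x∣ ∣x∣<1)))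

  1≤q^ : ∀ n → 1 ℕ.≤ q ℕ.^ n
  1≤q^ zero    = ℕ.≤-refl
  1≤q^ (suc n) = ℕ.*-mono-≤ 1≤q (1≤q^ n)

  2≤q^suc : ∀ n → 2 ℕ.≤ q ℕ.^ suc n
  2≤q^suc n = ℕ.*-mono-≤ F.2≤q (1≤q^ n)

  -- Write x as x^{q^{i+1}} - [i+1]. The first term is strictly smaller than x, so the second one
  -- must dominate.
  ∣x∣≤∣[suc]∣ : ∀ i → ∣ x ∣ ℝ.≤ ∣ [ suc i ] ∣
  ∣x∣≤∣[suc]∣ i with ∣-∣-selective (x ^ (q ℕ.^ suc i)) [ suc i ]
  ... | inj₁ p = ⊥-elim (ℝ.<⇒≱ (∣x^n∣<∣x∣ (2≤q^suc i)) (ℝ.≤-respˡ (∣∣-cong (solve 2 (λ a x → a :- (a :- x) := x) refl _ x)) p))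
  ... | inj₂ p = ℝ.≤-respˡ (∣∣-cong (solve 2 (λ a x → a :- (a :- x) := x) refl _ x)) p

  [suc]≉0 : ∀ i → ¬ ([ suc i ] ≈ 0#)
  [suc]≉0 i p = ℝ.<⇒≱ 0<∣x∣ (ℝ.≤-respʳ (∣∣≈0 p) (∣x∣≤∣[suc]∣ i))

  D-suc : ∀ i → D (suc i) ≈ [ suc i ] * D i ^ q
  D-suc i = *-cong (*-identityʳ [ suc i ]) (trans
    (product-cong {i} (λ j → ^q^suc [ i ∸ toℕ j ] (toℕ j)))
    (sym (product-^ {i} (λ j → [ i ∸ toℕ j ] ^ (q ℕ.^ toℕ j)) q)))

  D≉0 : ∀ i → ¬ (D i ≈ 0#)
  D≉0 zero    = 0≉1 ∘ sym
  D≉0 (suc i) p = *-nonzero ([suc]≉0 i) (^-nonzero (D≉0 i) q) (trans (sym (D-suc i)) p)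

  -- φ i z = f_i(z) for every z in K̄_c, and h i z = f_i(z)/z, also at z = 0.
  h φ : ℕ → Carrier → Carrier
  h zero    z = 1#
  h (suc i) z = [ suc i ] ⁻¹ * (((z * h i z) ^ (q ∸ 1) - 1#) * h i z)
  φ i z = z * h i z

  -- Carlitz' recursion; `h` is defined from the factorization y^q - y = y (y^{q-1} - 1) at y =
  -- f_i(z). Cancelling [i+1] reduces identities for f_{i+1} to identities for f_i and the
  -- additivity of Frobenius.
  φ-suc : ∀ i z → [ suc i ] * φ (suc i) z ≈ φ i z ^ q - φ i z
  φ-suc i z = begin
    [ suc i ] * (z * ([ suc i ] ⁻¹ * ((φ i z ^ (q ∸ 1) - 1#) * h i z)))
      ≈⟨ solve 4 (λ u z v w → u :* (z :* (v :* w)) := u :* (v :* (z :* w))) refl [ suc i ] z _ _ ⟩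
    [ suc i ] * ([ suc i ] ⁻¹ * (z * ((φ i z ^ (q ∸ 1) - 1#) * h i z)))
      ≈⟨ ⁻¹-cancelʳ ([suc]≉0 i) _ ⟩
    z * ((φ i z ^ (q ∸ 1) - 1#) * h i z)
      ≈⟨ solve 4 (λ z p o w → z :* ((p :- o) :* w) := (z :* w) :* p :- o :* (z :* w)) refl z _ 1# _ ⟩
    φ i z * φ i z ^ (q ∸ 1) - 1# * φ i z
      ≈⟨ +-cong (sym (^-suc∸1 _ q 1≤q)) (-‿cong (*-identityˡ _)) ⟩
    φ i z ^ q - φ i z  ∎

  φ-cong : ∀ i {z w} → z ≈ w → φ i z ≈ φ i w
  φ-cong zero    z≈w = *-congʳ z≈w
  φ-cong (suc i) {z} {w} z≈w = *-cancelˡ ([suc]≉0 i) (begin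
    [ suc i ] * φ (suc i) z  ≈⟨ φ-suc i z ⟩
    φ i z ^ q - φ i z        ≈⟨ +-cong (^-congˡ q (φ-cong i z≈w)) (-‿cong (φ-cong i z≈w)) ⟩
    φ i w ^ q - φ i w        ≈⟨ φ-suc i w ⟨
    [ suc i ] * φ (suc i) w  ∎)

  φ-+ : ∀ i z w → φ i (z + w) ≈ φ i z + φ i w
  φ-+ zero    z w = distribʳ 1# z w
  φ-+ (suc i) z w = *-cancelˡ ([suc]≉0 i) (begin
    [ suc i ] * φ (suc i) (z + w)                       ≈⟨ φ-suc i (z + w) ⟩
    φ i (z + w) ^ q - φ i (z + w)                       ≈⟨ +-cong (trans (^-congˡ q (φ-+ i z w)) (^q-+ _ _)) (-‿cong (φ-+ i z w)) ⟩
    φ i z ^ q + φ i w ^ q - (φ i z + φ i w)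
      ≈⟨ solve 4 (λ a b c d → a :+ b :- (c :+ d) := (a :- c) :+ (b :- d)) refl _ _ _ _ ⟩
    (φ i z ^ q - φ i z) + (φ i w ^ q - φ i w)           ≈⟨ +-cong (φ-suc i z) (φ-suc i w) ⟨
    [ suc i ] * φ (suc i) z + [ suc i ] * φ (suc i) w   ≈⟨ distribˡ _ _ _ ⟨
    [ suc i ] * (φ (suc i) z + φ (suc i) w)             ∎)

  φ-- : ∀ i z w → φ i (z - w) ≈ φ i z - φ i w
  φ-- i z w = begin
    φ i (z - w)                  ≈⟨ solve 2 (λ u v → u := (u :+ v) :- v) refl _ (φ i w) ⟩
    φ i (z - w) + φ i w - φ i w  ≈⟨ +-congʳ (φ-+ i (z - w) w) ⟨
    φ i (z - w + w) - φ i w      ≈⟨ +-congʳ (φ-cong i (solve 2 (λ a b → a :- b :+ b := a) refl z w)) ⟩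
    φ i z - φ i w                ∎

  φ-τ : ∀ i α z → φ i (τ α * z) ≈ τ α * φ i z
  φ-τ zero    α z = *-assoc _ _ _
  φ-τ (suc i) α z = *-cancelˡ ([suc]≉0 i) (begin
    [ suc i ] * φ (suc i) (τ α * z)          ≈⟨ φ-suc i (τ α * z) ⟩
    φ i (τ α * z) ^ q - φ i (τ α * z)        ≈⟨ +-cong (trans (^-congˡ q (φ-τ i α z)) (trans (^-distrib-* _ _ q) (*-congʳ (τ-fermat α)))) (-‿cong (φ-τ i α z)) ⟩
    τ α * φ i z ^ q - τ α * φ i z            ≈⟨ solve 3 (λ a b c → a :* b :- a :* c := a :* (b :- c)) refl _ _ _ ⟩
    τ α * (φ i z ^ q - φ i z)                ≈⟨ *-congˡ (φ-suc i z) ⟨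
    τ α * ([ suc i ] * φ (suc i) z)          ≈⟨ solve 3 (λ a b c → a :* (b :* c) := b :* (a :* c)) refl _ _ _ ⟩
    [ suc i ] * (τ α * φ (suc i) z)          ∎)

  private
    -- The defect b = f_i(xz) - x f_i(z) is 0 for i = 0 and f_{i-1}(z)^q otherwise; leaving it
    -- abstract lets both cases share the computation. The condition on b^q - b trades x^q for
    -- x^{q^{i+1}}, so that exactly the coefficient [i+1] is left to cancel.
    φ-x-step : ∀ i z b → φ i (x * z) ≈ x * φ i z + b → b ^ q - b ≈ (x ^ (q ℕ.^ suc i) - x ^ q) * φ i z ^ q →
               φ (suc i) (x * z) ≈ x * φ (suc i) z + φ i z ^ q
    φ-x-step i z b eq b^q-b = *-cancelˡ ([suc]≉0 i) (begin
      [ suc i ] * φ (suc i) (x * z)             ≈⟨ φ-suc i (x * z) ⟩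
      φ i (x * z) ^ q - φ i (x * z)             ≈⟨ +-cong (trans (^-congˡ q eq) (trans (^q-+ _ _) (+-congʳ (^-distrib-* x _ q)))) (-‿cong eq) ⟩
      x ^ q * a ^ q + b ^ q - (x * a + b)
        ≈⟨ solve 5 (λ c d x a b → c :+ d :- (x :* a :+ b) := c :- x :* a :+ (d :- b)) refl _ _ x a b ⟩
      x ^ q * a ^ q - x * a + (b ^ q - b)       ≈⟨ +-congˡ b^q-b ⟩
      x ^ q * a ^ q - x * a + (x ^ (q ℕ.^ suc i) - x ^ q) * a ^ q
        ≈⟨ solve 5 (λ u v x a w → u :* v :- x :* a :+ (w :- u) :* v := x :* (v :- a) :+ (w :- x) :* v) refl (x ^ q) (a ^ q) x a (x ^ (q ℕ.^ suc i)) ⟩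
      x * (a ^ q - a) + [ suc i ] * a ^ q       ≈⟨ +-congʳ (*-congˡ (φ-suc i z)) ⟨
      x * ([ suc i ] * φ (suc i) z) + [ suc i ] * a ^ q
        ≈⟨ solve 4 (λ x b f c → x :* (b :* f) :+ b :* c := b :* (x :* f :+ c)) refl x _ _ _ ⟩
      [ suc i ] * (x * φ (suc i) z + a ^ q)     ∎)
      where a = φ i z

  φ-x : ∀ i z → φ (suc i) (x * z) ≈ x * φ (suc i) z + φ i z ^ q
  φ-x zero    z = φ-x-step zero z 0# (trans (*-assoc x z 1#) (sym (+-identityʳ _))) (begin
    0# ^ q - 0#                                    ≈⟨ +-congʳ (0^ q 1≤q) ⟩
    0# - 0#                                        ≈⟨ -‿inverseʳ 0# ⟩
    0#                                             ≈⟨ zeroˡ _ ⟨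
    0# * φ 0 z ^ q                                 ≈⟨ *-congʳ (a≈b⇒a-b≈0 (^-congʳ x (ℕ.*-identityʳ q))) ⟨
    (x ^ (q ℕ.^ 1) - x ^ q) * φ 0 z ^ q            ∎)
  φ-x (suc i) z = φ-x-step (suc i) z (φ i z ^ q) (φ-x i z) (begin
    (φ i z ^ q) ^ q - φ i z ^ q                    ≈⟨ ^q-- _ _ ⟨
    (φ i z ^ q - φ i z) ^ q                        ≈⟨ ^-congˡ q (φ-suc i z) ⟨
    ([ suc i ] * φ (suc i) z) ^ q                  ≈⟨ ^-distrib-* _ _ q ⟩
    [ suc i ] ^ q * φ (suc i) z ^ q                ≈⟨ *-congʳ (trans (^q-- _ _) (+-congʳ (sym (^q^suc x (suc i))))) ⟩
    (x ^ (q ℕ.^ suc (suc i)) - x ^ q) * φ (suc i) z ^ q  ∎)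

  φ-fixed⇒φ-suc≈0 : ∀ i {z} → φ i z ^ q ≈ φ i z → φ (suc i) z ≈ 0#
  φ-fixed⇒φ-suc≈0 i {z} eq = a*b≈0⇒b≈0 ([suc]≉0 i) (trans (φ-suc i z) (a≈b⇒a-b≈0 eq))

  φ-1 : ∀ i → φ (suc i) 1# ≈ 0#
  φ-1 i = φ-fixed⇒φ-suc≈0 i (fixed i)
    where
    fixed : ∀ i → φ i 1# ^ q ≈ φ i 1#
    fixed zero    = trans (^-congˡ q (*-identityʳ 1#)) (trans (1^ q) (sym (*-identityʳ 1#)))
    fixed (suc i) = trans (^-congˡ q (φ-1 i)) (trans (0^ q 1≤q) (sym (φ-1 i)))

  -- In f_{i+1}(x · x^i) = x f_{i+1}(x^i) + f_i(x^i)^q the first term vanishes, because f_i(x^i) = 1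
  -- is fixed by Frobenius. This is the purpose of the normalization by D_i.
  φ-x^ : ∀ i → φ i (x ^ i) ≈ 1#
  φ-x^ zero    = *-identityʳ 1#
  φ-x^ (suc i) = begin
    φ (suc i) (x * x ^ i)                      ≈⟨ φ-x i (x ^ i) ⟩
    x * φ (suc i) (x ^ i) + φ i (x ^ i) ^ q    ≈⟨ +-cong (trans (*-congˡ (φ-fixed⇒φ-suc≈0 i fixed)) (zeroʳ x)) φ^q≈1 ⟩
    0# + 1#                                    ≈⟨ +-identityˡ 1# ⟩
    1#                                         ∎
    where
    φ^q≈1 : φ i (x ^ i) ^ q ≈ 1#
    φ^q≈1 = trans (^-congˡ q (φ-x^ i)) (1^ q)
    fixed : φ i (x ^ i) ^ q ≈ φ i (x ^ i)
    fixed = trans φ^q≈1 (sym (φ-x^ i))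

  -- ∏_{deg m < i} g(m)
  productₚ : ∀ i → (Carrier → Carrier) → Carrier
  productₚ i g = product {q ℕ.^ i} (λ a → g (poly i a))

  Congruent : (Carrier → Carrier) → Set
  Congruent g = ∀ {a b} → a ≈ b → g a ≈ g b

  poly-combine : ∀ i α m → poly (suc i) (combine α m) ≈ τᵢ α + x * poly i m
  poly-combine i α m = +-cong
    (trans (*-identityʳ _) (reflexive (≡.cong (τᵢ ∘ proj₁) (Fin.remQuot-combine α m))))
    (trans (sum-cong {i} λ j → trans
        (*-congʳ (reflexive (≡.cong (λ p → τᵢ (finToFun {q} {i} (proj₂ p) j)) (Fin.remQuot-combine α m))))
        (solve 3 (λ a x y → a :* (x :* y) := x :* (a :* y)) refl _ x _))
      (sym (*-distribˡ-sum {i} x _)))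

  productₚ-cong : ∀ i {g g′} → (∀ m → g m ≈ g′ m) → productₚ i g ≈ productₚ i g′
  productₚ-cong i eq = product-cong {q ℕ.^ i} (λ a → eq (poly i a))

  productₚ-suc : ∀ i {g} → Congruent g →
                 productₚ (suc i) g ≈ product {q} (λ α → productₚ i (λ m → g (τᵢ α + x * m)))
  productₚ-suc i {g} g-cong = trans (product-combine q (q ℕ.^ i) (λ a → g (poly (suc i) a)))
    (product-cong {q} λ α → product-cong {q ℕ.^ i} λ m → g-cong (poly-combine i α m))

  -- finToFun makes the constant coefficient the outermost digit, whereas the recursion
  -- e_{i+1}(z) = ∏_α e_i(z − α x^i) splits off the leading one.
  productₚ-top : ∀ i {g} → Congruent g →
                 productₚ (suc i) g ≈ product {q} (λ α → productₚ i (λ m → g (m + τᵢ α * x ^ i)))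
  productₚ-top zero {g} g-cong = trans (productₚ-suc zero g-cong)
    (product-cong {q} λ α → *-congʳ (g-cong (begin
      τᵢ α + x * 0#   ≈⟨ +-congˡ (zeroʳ x) ⟩
      τᵢ α + 0#       ≈⟨ +-comm _ _ ⟩
      0# + τᵢ α       ≈⟨ +-congˡ (*-identityʳ _) ⟨
      0# + τᵢ α * 1#  ∎)))
  productₚ-top (suc i) {g} g-cong = begin
    productₚ (suc (suc i)) g
      ≈⟨ productₚ-suc (suc i) g-cong ⟩
    product {q} (λ β → productₚ (suc i) (λ m → g (τᵢ β + x * m)))
      ≈⟨ product-cong {q} (λ β → productₚ-top i λ p → g-cong (+-congˡ (*-congˡ p))) ⟩
    -- The constant digit β has been split off and the induction hypothesis has split off the top
    -- digit α of the remainder; exchanging the two products lets β be absorbed again.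
    product {q} (λ β → product {q} (λ α → productₚ i (λ m → g (τᵢ β + x * (m + τᵢ α * x ^ i)))))
      ≈⟨ product-comm {q} {q} _ ⟩
    product {q} (λ α → product {q} (λ β → productₚ i (λ m → g (τᵢ β + x * (m + τᵢ α * x ^ i)))))
      ≈⟨ product-cong {q} (λ α → product-cong {q} λ β → productₚ-cong i λ m → g-cong
           (solve 5 (λ b x m a y → b :+ x :* (m :+ a :* y) := b :+ x :* m :+ a :* (x :* y)) refl _ x m _ _)) ⟩
    product {q} (λ α → product {q} (λ β → productₚ i (λ m → g (τᵢ β + x * m + τᵢ α * x ^ suc i))))
      ≈⟨ product-cong {q} (λ α → productₚ-suc i λ p → g-cong (+-congʳ p)) ⟨
    product {q} (λ α → productₚ (suc i) (λ m → g (m + τᵢ α * x ^ suc i)))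
      ∎

  -- Linearity and f_i(x^i) = 1 turn e_i(z - α x^i) into D_i (f_i(z) - α). The product over all α is
  -- D_i^q (f_i(z)^q - f_i(z)), where the recursions of f and of D meet.
  productₚ≈D*φ : ∀ i z → productₚ i (λ m → z - m) ≈ D i * φ i z
  productₚ≈D*φ zero z = begin
    (z - 0#) * 1#  ≈⟨ *-congʳ (a-0≈a z) ⟩
    z * 1#         ≈⟨ *-identityˡ _ ⟨
    1# * (z * 1#)  ∎
  productₚ≈D*φ (suc i) z = begin
    productₚ (suc i) (λ m → z - m)
      ≈⟨ productₚ-top i (λ p → +-congˡ (-‿cong p)) ⟩
    product {q} (λ α → productₚ i (λ m → z - (m + τᵢ α * x ^ i)))
      ≈⟨ product-cong {q} (λ α → trans
           (productₚ-cong i λ m → solve 3 (λ z m y → z :- (m :+ y) := (z :- y) :- m) refl z m _)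
           (productₚ≈D*φ i (z - τᵢ α * x ^ i))) ⟩
    product {q} (λ α → D i * φ i (z - τᵢ α * x ^ i))
      ≈⟨ product-cong {q} (λ α → *-congˡ (trans (φ-- i _ _) (+-congˡ (-‿cong
           (trans (φ-τ i _ _) (trans (*-congˡ (φ-x^ i)) (*-identityʳ _))))))) ⟩
    product {q} (λ α → D i * (φ i z - τᵢ α))
      ≈⟨ product-distrib-* {q} (λ _ → D i) _ ⟩
    product {q} (λ _ → D i) * product {q} (λ α → φ i z - τᵢ α)
      ≈⟨ *-cong (product-const q) (product-linear (φ i z)) ⟩
    D i ^ q * (φ i z ^ q - φ i z)
      ≈⟨ *-congˡ (φ-suc i z) ⟨
    D i ^ q * ([ suc i ] * φ (suc i) z)
      ≈⟨ solve 3 (λ a b c → a :* (b :* c) := (b :* a) :* c) refl _ _ _ ⟩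
    ([ suc i ] * D i ^ q) * φ (suc i) z
      ≈⟨ *-congʳ (D-suc i) ⟨
    D (suc i) * φ (suc i) z  ∎

  f≈φ : ∀ i t → f i t ≈ φ i ⟦ t ⟧
  f≈φ i t = trans (*-congˡ (e≈ i)) (⁻¹-cancelˡ (D≉0 i) _)
    where
    e≈ : ∀ i → e i t ≈ D i * φ i ⟦ t ⟧
    e≈ zero    = trans (sym (*-identityʳ _)) (sym (*-identityˡ _))
    e≈ (suc i) = productₚ≈D*φ (suc i) ⟦ t ⟧

  -- The n-th difference of f_i: it is f_{i-n}^{q^n} for n ≤ i, and 0 otherwise.
  G : ℕ → ℕ → Carrier → Carrier
  G zero    i       z = φ i z
  G (suc n) zero    z = 0#
  G (suc n) (suc i) z = G n i z ^ q

  -- Raising the identity for n to the q-th power changes the multiplier x^{q^n} into x^{q^{n+1}},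
  -- the one that the next difference operator uses.
  G-difference : ∀ n i z → G n i (x * z) - x ^ (q ℕ.^ n) * G n i z ≈ G (suc n) i z
  G-difference zero    zero    z = 
    a≈b⇒a-b≈0 (trans (*-assoc x z 1#) (*-congʳ (sym (*-identityʳ x))))
  G-difference zero    (suc i) z = trans (+-cong (φ-x i z) (-‿cong (*-congʳ (*-identityʳ x))))
    (solve 2 (λ a b → a :+ b :- a := b) refl _ _)
  G-difference (suc n) zero    z = a≈b⇒a-b≈0 (sym (zeroʳ _))
  G-difference (suc n) (suc i) z = begin
    G n i (x * z) ^ q - x ^ (q ℕ.^ suc n) * G n i z ^ q       ≈⟨ +-congˡ (-‿cong (trans (*-congʳ (^q^suc x n)) (sym (^-distrib-* _ _ q)))) ⟩
    G n i (x * z) ^ q - (x ^ (q ℕ.^ n) * G n i z) ^ q         ≈⟨ ^q-- _ _ ⟨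
    (G n i (x * z) - x ^ (q ℕ.^ n) * G n i z) ^ q             ≈⟨ ^-congˡ q (G-difference n i z) ⟩
    G (suc n) i z ^ q                                         ∎

  G-diagonal : ∀ n i z → G n (n ℕ.+ i) z ≈ φ i z ^ (q ℕ.^ n)
  G-diagonal zero    i z = sym (*-identityʳ _)
  G-diagonal (suc n) i z = trans (^-congˡ q (G-diagonal n i z)) (sym (^q^suc _ n))

  G-below : ∀ {n i} → i ℕ.< n → ∀ z → G n i z ≈ 0#
  G-below {suc n} {zero}  _         z = refl
  G-below {suc n} {suc i} (s≤s i<n) z = trans (^-congˡ q (G-below i<n z)) (0^ q 1≤q)

  -- Together with `G-1-off` this says that the functionals u ↦ Δⁿu(1) are dual to the f_i, which
  -- isolates a single coefficient of an expansion.
  G-1-diagonal : ∀ n → G n n 1# ≈ 1#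
  G-1-diagonal zero    = *-identityʳ 1#
  G-1-diagonal (suc n) = trans (^-congˡ q (G-1-diagonal n)) (1^ q)

  G-1-off : ∀ n i → i ≢ n → G n i 1# ≈ 0#
  G-1-off zero    zero    i≢n = ⊥-elim (i≢n ≡.refl)
  G-1-off zero    (suc i) i≢n = φ-1 i
  G-1-off (suc n) zero    i≢n = refl
  G-1-off (suc n) (suc i) i≢n = trans (^-congˡ q (G-1-off n i (i≢n ∘ ≡.cong suc))) (0^ q 1≤q)

-- Size and continuity of f_i(z) and f_i(z)/z.

module Estimates (ℝ : CompleteOrderedField) {q} (F : FiniteField q) (C : CompletedAlgebraicClosure ℝ F) where
  private
    module ℝ where
      open CompleteOrderedField ℝ public
      open RealProperties ℝ public
  open CompletedAlgebraicClosure C hiding (zero)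
  open FieldProperties 𝔽
  open IntegerCoefficients commutativeRing
  open ValuedFieldProperties ℝ F C
  open CarlitzPolynomials ℝ F C
  open Carlitz ℝ F C using ([_]; Continuous; O; ⟦_⟧)
  open ℝ.≤-Reasoning

  -- A single constant bounds both the values and the difference quotients. This makes the notion
  -- multiplicative, by g g′(z) - g g′(w) = g(z)(g′(z) - g′(w)) + g′(w)(g(z) - g(w)). Apart from
  -- continuity it supplies the crude bound from which digit peeling starts.
  record Lipschitz (g : Carrier → Carrier) : Set where
    field
      bound     : ℝ.Carrier
      bounded   : ∀ z → ∣ z ∣ ℝ.≤ ℝ.1# → ∣ g z ∣ ℝ.≤ bound
      lipschitz : ∀ z w → ∣ z ∣ ℝ.≤ ℝ.1# → ∣ w ∣ ℝ.≤ ℝ.1# → ∣ g z - g w ∣ ℝ.≤ bound ℝ.* ∣ z - w ∣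

  open Lipschitz

  Lipschitz-const : ∀ c → Lipschitz (λ _ → c)
  Lipschitz-const c = record
    { bound = ∣ c ∣
    ; bounded = λ _ _ → ℝ.≤-refl
    ; lipschitz = λ z w _ _ → ℝ.≤-respˡ (ℝ.sym (∣∣≈0 (-‿inverseʳ c))) (ℝ.*-nonneg (∣∣-nonneg c) (∣∣-nonneg (z - w)))
    }

  Lipschitz-id : Lipschitz (λ z → z)
  Lipschitz-id = record
    { bound = ℝ.1#
    ; bounded = λ _ p → p
    ; lipschitz = λ _ _ _ _ → ℝ.≤-reflexive (ℝ.sym (ℝ.*-identityˡ _))
    }

  Lipschitz-+ : ∀ {g g′} → Lipschitz g → Lipschitz g′ → Lipschitz (λ z → g z + g′ z)
  Lipschitz-+ {g} {g′} L L′ = record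
    { bound = bound L ℝ.⊔ bound L′
    ; bounded = λ z p → ∣+∣-≤ (ℝ.≤-trans (bounded L z p) (ℝ.x≤x⊔y _ _)) (ℝ.≤-trans (bounded L′ z p) (ℝ.x≤y⊔x _ _))
    ; lipschitz = λ z w p p′ → ℝ.≤-respˡ
        (∣∣-cong (solve 4 (λ a b c d → (a :- b) :+ (c :- d) := (a :+ c) :- (b :+ d)) refl (g z) (g w) (g′ z) (g′ w)))
        (∣+∣-≤ (ℝ.≤-trans (lipschitz L z w p p′) (ℝ.*-monoˡ-≤ (∣∣-nonneg _) (ℝ.x≤x⊔y _ _)))
               (ℝ.≤-trans (lipschitz L′ z w p p′) (ℝ.*-monoˡ-≤ (∣∣-nonneg _) (ℝ.x≤y⊔x _ _))))
    }

  Lipschitz-* : ∀ {g g′} → Lipschitz g → Lipschitz g′ → Lipschitz (λ z → g z * g′ z)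
  Lipschitz-* {g} {g′} L L′ = record
    { bound = bound L ℝ.* bound L′
    ; bounded = λ z p → ∣*∣-≤ (bounded L z p) (bounded L′ z p)
    ; lipschitz = λ z w p p′ → ℝ.≤-respˡ
        (∣∣-cong (solve 4 (λ a b c d → a :* (c :- d) :+ d :* (a :- b) := a :* c :- b :* d) refl (g z) (g w) (g′ z) (g′ w)))
        (∣+∣-≤ (ℝ.≤-respʳ (ℝ.sym (ℝ.*-assoc _ _ _)) (∣*∣-≤ (bounded L z p) (lipschitz L′ z w p p′)))
               (ℝ.≤-respʳ (ℝ.trans (ℝ.sym (ℝ.*-assoc _ _ _)) (ℝ.*-congʳ (ℝ.*-comm _ _)))
                 (∣*∣-≤ (bounded L′ w p′) (lipschitz L z w p p′))))
    }

  Lipschitz-^ : ∀ {g} → Lipschitz g → ∀ n → Lipschitz (λ z → g z ^ n)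
  Lipschitz-^ L zero    = Lipschitz-const 1#
  Lipschitz-^ L (suc n) = Lipschitz-* L (Lipschitz-^ L n)

  Lipschitz-sum : ∀ n {g : Fin n → Carrier → Carrier} → (∀ i → Lipschitz (g i)) → Lipschitz (λ z → sum (λ i → g i z))
  Lipschitz-sum zero    L = Lipschitz-const 0#
  Lipschitz-sum (suc n) L = Lipschitz-+ (L zero) (Lipschitz-sum n (L ∘ suc))

  Lipschitz-h : ∀ i → Lipschitz (h i)
  Lipschitz-h zero    = Lipschitz-const 1#
  Lipschitz-h (suc i) = Lipschitz-* (Lipschitz-const _)
    (Lipschitz-* (Lipschitz-+ (Lipschitz-^ (Lipschitz-* Lipschitz-id (Lipschitz-h i)) (q ∸ 1)) (Lipschitz-const _)) (Lipschitz-h i))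

  Lipschitz⇒Continuous : ∀ {g} → Lipschitz g → Continuous (g ∘ ⟦_⟧)
  Lipschitz⇒Continuous {g} L t₀ ε 0<ε = M ℝ.⁻¹ ℝ.* ε , ℝ.*-pos (ℝ.⁻¹-pos 0<M) 0<ε , λ t near → begin-strict
    ∣ g ⟦ t ⟧ - g ⟦ t₀ ⟧ ∣            ≤⟨ lipschitz L _ _ (proj₂ t) (proj₂ t₀) ⟩
    bound L ℝ.* ∣ ⟦ t ⟧ - ⟦ t₀ ⟧ ∣    ≤⟨ ℝ.*-monoˡ-≤ (∣∣-nonneg _) (ℝ.x≤x⊔y _ _) ⟩
    M ℝ.* ∣ ⟦ t ⟧ - ⟦ t₀ ⟧ ∣          <⟨ ℝ.*-monoʳ-< 0<M near ⟩
    M ℝ.* (M ℝ.⁻¹ ℝ.* ε)              ≈⟨ ℝ.⁻¹-cancelʳ (ℝ.0<⇒≉0 0<M) ε ⟩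
    ε                                 ∎
    where
    -- The bound may be 0; joining it with 1 makes it invertible.
    M = bound L ℝ.⊔ ℝ.1#
    0<M : ℝ.0# ℝ.< M
    0<M = ℝ.<-≤-trans ℝ.0<1 (ℝ.x≤y⊔x _ _)

  Q*∣x*a∣≈∣a∣ : ∀ a → Q ℝ.* ∣ x * a ∣ ℝ.≈ ∣ a ∣
  Q*∣x*a∣≈∣a∣ a = begin-equality
    Q ℝ.* ∣ x * a ∣          ≈⟨ ℝ.*-congˡ (∣∣-* x a) ⟩
    Q ℝ.* (∣ x ∣ ℝ.* ∣ a ∣)  ≈⟨ ℝ.*-assoc _ _ _ ⟨
    Q ℝ.* ∣ x ∣ ℝ.* ∣ a ∣    ≈⟨ ℝ.*-congʳ (ℝ.trans (ℝ.*-comm _ _) ∣x∣*Q≈1) ⟩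
    ℝ.1# ℝ.* ∣ a ∣           ≈⟨ ℝ.*-identityˡ _ ⟩
    ∣ a ∣                    ∎

  Lipschitz-φ : ∀ i → Lipschitz (φ i)
  Lipschitz-φ i = Lipschitz-* Lipschitz-id (Lipschitz-h i)

  private
    -- φ_{i+1}(α + x t) = x φ_{i+1}(t) + φ_i(t)^q, so every digit peeled off t gains a factor q.
    peel-digit : ∀ i m {B z} α t → z ≈ τ α + x * t → ∣ φ i t ∣ ℝ.≤ ℝ.1# →
                 (∣ φ (suc i) t ∣ ℝ.≤ ℝ.1#) ⊎ (Q ℝ.^ m ℝ.* ∣ φ (suc i) t ∣ ℝ.≤ B) →
                 (∣ φ (suc i) z ∣ ℝ.≤ ℝ.1#) ⊎ (Q ℝ.^ suc m ℝ.* ∣ φ (suc i) z ∣ ℝ.≤ B)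
    -- The sum x f_{i+1}(t) + f_i(t)^q is treated as a difference with -f_i(t)^q, so that the
    -- dominating term can be selected.
    peel-digit i m {B} {z} α t eq ∣φ∣≤1 = go (∣-∣-selective (x * a) (- b))
      where
      a = φ (suc i) t
      b = φ i t ^ q
      expand : x * a - - b ≈ φ (suc i) z
      expand = sym (trans (φ-cong (suc i) (trans eq (+-congʳ (sym (*-identityʳ (τ α))))))
        (trans (φ-+ (suc i) _ _) (trans (+-cong (trans (φ-τ (suc i) α 1#) (trans (*-congˡ (φ-1 i)) (zeroʳ _))) (φ-x i t))
          (trans (+-identityˡ _) (solve 2 (λ u v → u :+ v := u :- (:- v)) refl (x * a) b)))))
      go : (∣ x * a - - b ∣ ℝ.≤ ∣ x * a ∣) ⊎ (∣ x * a - - b ∣ ℝ.≤ ∣ - b ∣) →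
           (∣ a ∣ ℝ.≤ ℝ.1#) ⊎ (Q ℝ.^ m ℝ.* ∣ a ∣ ℝ.≤ B) →
           (∣ φ (suc i) z ∣ ℝ.≤ ℝ.1#) ⊎ (Q ℝ.^ suc m ℝ.* ∣ φ (suc i) z ∣ ℝ.≤ B)
      go (inj₂ r) _ = inj₁ (begin
        ∣ φ (suc i) z ∣      ≈⟨ ∣∣-cong expand ⟨
        ∣ x * a - - b ∣      ≤⟨ r ⟩
        ∣ - b ∣              ≈⟨ ∣-∣ b ⟩
        ∣ b ∣                ≤⟨ ∣^∣≤1 q ∣φ∣≤1 ⟩
        ℝ.1#                 ∎)
      go (inj₁ r) (inj₁ a≤1) = inj₁ (begin
        ∣ φ (suc i) z ∣      ≈⟨ ∣∣-cong expand ⟨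
        ∣ x * a - - b ∣      ≤⟨ r ⟩
        ∣ x * a ∣            ≤⟨ ∣a*b∣≤∣b∣ a ∣x∣≤1 ⟩
        ∣ a ∣                ≤⟨ a≤1 ⟩
        ℝ.1#                 ∎)
      go (inj₁ r) (inj₂ small) = inj₂ (begin
        Q ℝ.* Q ℝ.^ m ℝ.* ∣ φ (suc i) z ∣    ≈⟨ ℝ.*-congˡ (∣∣-cong expand) ⟨
        Q ℝ.* Q ℝ.^ m ℝ.* ∣ x * a - - b ∣    ≤⟨ ℝ.*-monoʳ-≤ (ℝ.^-nonneg (ℝ.<⇒≤ 0<Q) (suc m)) r ⟩
        Q ℝ.* Q ℝ.^ m ℝ.* ∣ x * a ∣          ≈⟨ ℝ.*-congʳ (ℝ.*-comm _ _) ⟩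
        Q ℝ.^ m ℝ.* Q ℝ.* ∣ x * a ∣          ≈⟨ ℝ.*-assoc _ _ _ ⟩
        Q ℝ.^ m ℝ.* (Q ℝ.* ∣ x * a ∣)        ≈⟨ ℝ.*-congˡ (Q*∣x*a∣≈∣a∣ a) ⟩
        Q ℝ.^ m ℝ.* ∣ a ∣                    ≤⟨ small ⟩
        B                                    ∎)

    -- Either some digit already forces the bound 1, or the polynomial bound, applied to the series
    -- left after m digits, has been improved by q^m.
    peel : ∀ i → (∀ z → ∣ ι z ∣ ℝ.≤ ℝ.1# → ∣ φ i (ι z) ∣ ℝ.≤ ℝ.1#) → ∀ m z → ∣ ι z ∣ ℝ.≤ ℝ.1# →
           (∣ φ (suc i) (ι z) ∣ ℝ.≤ ℝ.1#) ⊎ (Q ℝ.^ m ℝ.* ∣ φ (suc i) (ι z) ∣ ℝ.≤ bound (Lipschitz-φ (suc i)))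
    peel i ∣φ∣≤1 zero    z p = inj₂ (ℝ.≤-respˡ (ℝ.sym (ℝ.*-identityˡ _)) (bounded (Lipschitz-φ (suc i)) (ι z) p))
    peel i ∣φ∣≤1 (suc m) z p =
      let α , z′ , p′ , eq = digit z p
      in peel-digit i m α (ι z′) eq (∣φ∣≤1 z′ p′) (peel i ∣φ∣≤1 m z′ p′)

  -- A value larger than 1 would have to satisfy q^m |f_{i+1}(z)| ≤ B for every m, with B fixed;
  -- choosing q^m > B refutes this.
  ∣φ∣≤1 : ∀ i z → ∣ ι z ∣ ℝ.≤ ℝ.1# → ∣ φ i (ι z) ∣ ℝ.≤ ℝ.1#
  ∣φ∣≤1 zero    z p = ℝ.≤-respˡ (∣∣-cong (sym (*-identityʳ (ι z)))) p
  ∣φ∣≤1 (suc i) z p with ∣ φ (suc i) (ι z) ∣ ℝ.≤? ℝ.1# | ℝ.Powers.^-unbounded 1<Q (bound (Lipschitz-φ (suc i)))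
  ... | yes r | _ = r
  ... | no ¬r | m , B<Q^m with peel i (∣φ∣≤1 i) m z p
  ... | inj₁ r = r
  ... | inj₂ r = ⊥-elim (ℝ.<⇒≱ B<Q^m (ℝ.≤-trans (ℝ.≤-respˡ (ℝ.*-identityʳ _)
      (ℝ.*-monoʳ-≤ (ℝ.^-nonneg (ℝ.<⇒≤ 0<Q) m) (ℝ.<⇒≤ (ℝ.≰⇒> ¬r)))) r))

  -- [i+1] h_{i+1} = (φ_i^{q-1} − 1) h_i, where |φ_i| ≤ 1 and |[i+1]| ≥ q^{-1}.
  ∣h∣≤Q^ : ∀ i z → ∣ ι z ∣ ℝ.≤ ℝ.1# → ∣ h i (ι z) ∣ ℝ.≤ Q ℝ.^ i
  ∣h∣≤Q^ zero    z p = ℝ.≤-reflexive ∣1∣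
  ∣h∣≤Q^ (suc i) z p = begin
    ∣ h (suc i) (ι z) ∣                          ≈⟨ Q*∣x*a∣≈∣a∣ _ ⟨
    Q ℝ.* ∣ x * h (suc i) (ι z) ∣                ≤⟨ ℝ.*-monoʳ-≤ (ℝ.<⇒≤ 0<Q) (begin
      ∣ x * h (suc i) (ι z) ∣                      ≈⟨ ∣∣-* _ _ ⟩
      ∣ x ∣ ℝ.* ∣ h (suc i) (ι z) ∣                ≤⟨ ℝ.*-monoˡ-≤ (∣∣-nonneg _) (∣x∣≤∣[suc]∣ i) ⟩
      ∣ [ suc i ] ∣ ℝ.* ∣ h (suc i) (ι z) ∣        ≈⟨ ∣∣-* _ _ ⟨
      ∣ [ suc i ] * h (suc i) (ι z) ∣              ≈⟨ ∣∣-cong (⁻¹-cancelʳ ([suc]≉0 i) _) ⟩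
      ∣ (φ i (ι z) ^ (q ∸ 1) - 1#) * h i (ι z) ∣   ≤⟨ ∣a*b∣≤∣b∣ _ (∣-∣-≤ (∣^∣≤1 (q ∸ 1) (∣φ∣≤1 i z p)) (ℝ.≤-reflexive ∣1∣)) ⟩
      ∣ h i (ι z) ∣                                ≤⟨ ∣h∣≤Q^ i z p ⟩
      Q ℝ.^ i                                      ∎) ⟩
    Q ℝ.* Q ℝ.^ i                                ∎

  sum-difference : ∀ n y (c a b : Fin n → Carrier) →
                   sum (λ i → c i * (a i - y * b i)) ≈ sum (λ i → c i * a i) - y * sum (λ i → c i * b i)
  sum-difference zero    y c a b = sym (trans (+-congˡ (-‿cong (zeroʳ y))) (a-0≈a 0#))
  sum-difference (suc n) y c a b = trans (+-congˡ (sum-difference n y (c ∘ suc) (a ∘ suc) (b ∘ suc)))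
    (solve 6 (λ c a y b s t → c :* (a :- y :* b) :+ (s :- y :* t) := (c :* a :+ s) :- y :* (c :* b :+ t)) refl (c zero) (a zero) y (b zero) _ _)

  ∣sum∣< : ∀ {ε} → ℝ.0# ℝ.< ε → ∀ n (v : Fin n → Carrier) → (∀ i → ∣ v i ∣ ℝ.< ε) → ∣ sum v ∣ ℝ.< ε
  ∣sum∣< 0<ε zero    v v<ε = ℝ.<-respˡ-≈ (ℝ.sym ∣0∣) 0<ε
  ∣sum∣< 0<ε (suc n) v v<ε = ℝ.<-respˡ-≈ (∣∣-cong (solve 2 (λ u v → u :- (:- v) := u :+ v) refl (v zero) _))
    (∣-∣-< (v<ε zero) (ℝ.<-respˡ-≈ (ℝ.sym (∣-∣ _)) (∣sum∣< 0<ε n (v ∘ suc) (v<ε ∘ suc))))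

-- A triangular recursion whose multipliers have absolute value at most 1.

module DifferenceScheme (ℝ : CompleteOrderedField) {q} (F : FiniteField q) (C : CompletedAlgebraicClosure ℝ F) where
  private
    module ℝ where
      open CompleteOrderedField ℝ public
      open RealProperties ℝ public
  open CompletedAlgebraicClosure C hiding (zero)
  open ValuedFieldProperties ℝ F C
  open ℝ.≤-Reasoning

  module _ (W₀ : ℕ → Carrier) (y : ℕ → Carrier) (∣y∣≤1 : ∀ n → ∣ y n ∣ ℝ.≤ ℝ.1#) where

    W : ℕ → ℕ → Carrier
    W zero    j = W₀ j
    W (suc n) j = W n (suc j) - y n * W n j

    -- Following the dominating term back through the rows ends at one entry of row 0. The index
    -- itself is needed later, as the point where g comes close to its supremum.
    ∣W∣≤∣W₀∣ : ∀ n j → ∃[ i ] ∣ W n j ∣ ℝ.≤ ∣ W₀ i ∣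
    ∣W∣≤∣W₀∣ zero    j = j , ℝ.≤-refl
    ∣W∣≤∣W₀∣ (suc n) j =
      [ (λ r → let i , p = ∣W∣≤∣W₀∣ n (suc j) in i , ℝ.≤-trans r p)
      , (λ r → let i , p = ∣W∣≤∣W₀∣ n j in i , ℝ.≤-trans r (ℝ.≤-trans (∣a*b∣≤∣b∣ _ (∣y∣≤1 n)) p))
      ]′ (∣-∣-selective (W n (suc j)) (y n * W n j))

    -- The gain of a factor q is asked of `y (suc n)` only: in the application `y 0` is 1, so decay
    -- can be measured from row 1 on.
    module _ (Q*∣y*a∣≤∣a∣ : ∀ n a → Q ℝ.* ∣ y (suc n) * a ∣ ℝ.≤ ∣ a ∣)
             {ε M} N (0≤M : ℝ.0# ℝ.≤ M) (small : ∀ j → N ℕ.≤ j → ∣ W 1 j ∣ ℝ.< ε) (bounded : ∀ j → ∣ W 1 j ∣ ℝ.≤ M) where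

      -- Apart from the contribution below ε, passing from W n to W (n+1) either shifts j or gains a factor q.
      ∣W∣-decay : ∀ n j → (∣ W (suc n) j ∣ ℝ.< ε) ⊎ (Q ℝ.^ (n ℕ.+ j) ℝ.* ∣ W (suc n) j ∣ ℝ.≤ Q ℝ.^ N ℝ.* M)
      ∣W∣-decay zero j =
        [ (λ N≤j → inj₁ (small j N≤j))
        -- For j up to N the weight q^j is at most q^N, whence the constant q^N M.
        , (λ j≤N → inj₂ (ℝ.*-mono-≤ (ℝ.^-nonneg (ℝ.<⇒≤ 0<Q) j) 0≤M (ℝ.^-monoʳ-≤ (ℝ.<⇒≤ 1<Q) j≤N) (bounded j)))
        ]′ (ℕ.≤-total N j)
      ∣W∣-decay (suc n) j =
        [ (λ r → Sum.map (ℝ.≤-<-trans r)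
            (λ p → ℝ.≤-trans (ℝ.*-monoʳ-≤ (ℝ.^-nonneg (ℝ.<⇒≤ 0<Q) (suc n ℕ.+ j)) r)
                     (ℝ.≤-respˡ (ℝ.*-congʳ (ℝ.^-congʳ Q (ℕ.+-suc n j))) p))
            (∣W∣-decay n (suc j)))
        , (λ r → Sum.map (λ p → ℝ.≤-<-trans r (ℝ.≤-<-trans (∣a*b∣≤∣b∣ _ (∣y∣≤1 (suc n))) p))
            (λ p → begin
              Q ℝ.* Q ℝ.^ (n ℕ.+ j) ℝ.* ∣ W (suc (suc n)) j ∣          ≤⟨ ℝ.*-monoʳ-≤ (ℝ.^-nonneg (ℝ.<⇒≤ 0<Q) (suc (n ℕ.+ j))) r ⟩
              Q ℝ.* Q ℝ.^ (n ℕ.+ j) ℝ.* ∣ y (suc n) * W (suc n) j ∣    ≈⟨ ℝ.trans (ℝ.*-congʳ (ℝ.*-comm _ _)) (ℝ.*-assoc _ _ _) ⟩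
              Q ℝ.^ (n ℕ.+ j) ℝ.* (Q ℝ.* ∣ y (suc n) * W (suc n) j ∣)  ≤⟨ ℝ.*-monoʳ-≤ (ℝ.^-nonneg (ℝ.<⇒≤ 0<Q) (n ℕ.+ j)) (Q*∣y*a∣≤∣a∣ n (W (suc n) j)) ⟩
              Q ℝ.^ (n ℕ.+ j) ℝ.* ∣ W (suc n) j ∣                      ≤⟨ p ⟩
              Q ℝ.^ N ℝ.* M                                            ∎)
            (∣W∣-decay n j))
        ]′ (∣-∣-selective (W (suc n) (suc j)) (y (suc n) * W (suc n) j))

    -- At j = 0 the decay estimate leaves either a value below ε or q^n |W (n+1) 0| ≤ q^N M, and the
    -- right-hand side is independent of n. The threshold is a successor because the estimate speaks
    -- of row n + 1.
    ∣W∣→0 : (∀ n a → Q ℝ.* ∣ y (suc n) * a ∣ ℝ.≤ ∣ a ∣) →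
            (∀ ε → ℝ.0# ℝ.< ε → ∃[ N ] ∀ j → N ℕ.≤ j → ∣ W 1 j ∣ ℝ.< ε) →
            ∀ ε → ℝ.0# ℝ.< ε → ∃[ N ] ∀ n → N ℕ.≤ n → ∣ W n 0 ∣ ℝ.< ε
    ∣W∣→0 Q*∣y*a∣≤∣a∣ W₁→0 ε 0<ε =
      let N , small = W₁→0 ε 0<ε
          M , ε≤M , bounded = ℝ.eventuallyBounded⇒bounded (λ j → ∣ W 1 j ∣) N ε (λ j N≤j → ℝ.<⇒≤ (small j N≤j))
          N′ , large = ℝ.Powers.archimedean 1<Q (Q ℝ.^ N ℝ.* M) 0<ε
      in suc N′ , conclude (∣W∣-decay Q*∣y*a∣≤∣a∣ N (ℝ.≤-trans (ℝ.<⇒≤ 0<ε) ε≤M) small bounded) large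
      where
      conclude : ∀ {N B} → (∀ n j → (∣ W (suc n) j ∣ ℝ.< ε) ⊎ (Q ℝ.^ (n ℕ.+ j) ℝ.* ∣ W (suc n) j ∣ ℝ.≤ B)) →
                 (∀ n → N ℕ.≤ n → B ℝ.< Q ℝ.^ n ℝ.* ε) → ∀ n → suc N ℕ.≤ n → ∣ W n 0 ∣ ℝ.< ε
      conclude decay large (suc n) (s≤s N≤n) =
        [ (λ p → p)
        , (λ p → ℝ.*-cancelʳ-< (ℝ.^-nonneg (ℝ.<⇒≤ 0<Q) n)
            (ℝ.≤-<-trans (ℝ.≤-respˡ (ℝ.*-congʳ (ℝ.^-congʳ Q (ℕ.+-identityʳ n))) p) (large n N≤n)))
        ]′ (decay n 0)

-- Carlitz expansions and the operators 𝔇ᵏ.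

module Expansion (ℝ : CompleteOrderedField) {q} (F : FiniteField q) (C : CompletedAlgebraicClosure ℝ F) where
  private
    module ℝ where
      open CompleteOrderedField ℝ public
      open RealProperties ℝ public
    module F where
      open FiniteField F public
      open FiniteFieldProperties F public
  open LaurentSeries F using (1ᴸ; 0ᴸ; X)
  open CompletedAlgebraicClosure C hiding (zero)
  open FieldProperties 𝔽
  open IntegerCoefficients commutativeRing
  open ValuedFieldProperties ℝ F C
  open CarlitzPolynomials ℝ F C
  open Estimates ℝ F C
  open Carlitz ℝ F C hiding ([_]; D; poly; e)
  open ℝ.≤-Reasoning
  private module ι-homo = IsRingHomomorphism ι-homo

  -- Iterating `x∙_` makes the step from x^j to x^{j+1} agree by definition with the shift in `Δ`.
  x^ : ℕ → O
  x^ zero    = 1ᴸ , ∣const∣≤1 F.1#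
  x^ (suc j) = x∙ x^ j

  ⟦x∙⟧ : ∀ t → ⟦ x∙ t ⟧ ≈ x * ⟦ t ⟧
  ⟦x∙⟧ t = ι-homo.*-homo X (proj₁ t)

  ⟦x^⟧ : ∀ j → ⟦ x^ j ⟧ ≈ x ^ j
  ⟦x^⟧ zero    = τ-1
  ⟦x^⟧ (suc j) = trans (⟦x∙⟧ (x^ j)) (*-congˡ (⟦x^⟧ j))

  x^-nonzero : ∀ j → Nonzero (x^ j)
  x^-nonzero j p = ^-nonzero x≉0 j (trans (sym (⟦x^⟧ j)) (ι-zero p))

  x^→0 : ∀ δ → ℝ.0# ℝ.< δ → ∃[ N ] ∀ j → N ℕ.≤ j → ∣ ⟦ x^ j ⟧ ∣ ℝ.< δ
  x^→0 δ 0<δ = let N , p = ℝ.Powers.archimedean 1<Q ℝ.1# 0<δ in N , λ j N≤j → ℝ.<-respˡ-≈ (ℝ.sym (∣∣-cong (⟦x^⟧ j)))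
    (ℝ.*-cancelʳ-< (ℝ.^-nonneg (ℝ.<⇒≤ 0<Q) j) (ℝ.<-respˡ-≈ (ℝ.sym (Q^*∣x^∣≈1 j)) (p j N≤j)))

  -- Zero has many presentations as a Laurent series, so t is any point of value 0 and not one fixed
  -- series.
  x^→zero : ∀ {g} → Continuous g → ∀ t → ⟦ t ⟧ ≈ 0# → ∀ ε → ℝ.0# ℝ.< ε →
            ∃[ N ] ∀ j → N ℕ.≤ j → ∣ g (x^ j) - g t ∣ ℝ.< ε
  x^→zero g-continuous t t≈0 ε 0<ε =
    let δ , 0<δ , near = g-continuous t ε 0<ε
        N , small = x^→0 δ 0<δ
    in N , λ j N≤j → near (x^ j)
    (ℝ.<-respˡ-≈ (∣∣-cong (sym (trans (+-congˡ (-‿cong t≈0)) (a-0≈a _)))) (small j N≤j))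

  G-cong : ∀ n i {z w} → z ≈ w → G n i z ≈ G n i w
  G-cong zero    i       z≈w = φ-cong i z≈w
  G-cong (suc n) zero    z≈w = refl
  G-cong (suc n) (suc i) z≈w = ^-congˡ q (G-cong n i z≈w)

  ∣y*l-d∣<ε : ∀ {y a l d ε} → ∣ y ∣ ℝ.≤ ℝ.1# → ∣ a - l ∣ ℝ.< ε → ∣ d - y * a ∣ ℝ.< ε → ∣ y * l - d ∣ ℝ.< ε
  ∣y*l-d∣<ε {y} {a} {l} {d} ∣y∣≤1 a-near d-near = ∣-∣-trans-<
    (ℝ.<-respˡ-≈ (∣∣-cong (solve 3 (λ y l a → y :* (l :- a) := y :* l :- y :* a) refl y l a))
      (ℝ.≤-<-trans (∣a*b∣≤∣b∣ (l - a) ∣y∣≤1) (ℝ.<-respˡ-≈ (∣a-b∣≈∣b-a∣ a l) a-near)))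
    (ℝ.<-respˡ-≈ (∣a-b∣≈∣b-a∣ d (y * a)) d-near)

  -- Differences of the partial sums and recovery of the coefficients.

  module Coefficients (u : O → Carrier) (c : ℕ → Carrier) (expansion : IsCarlitzExpansion u c) where
    open IsCarlitzExpansion expansion

    -- Each difference operator combines two values with multipliers of absolute value at most 1, so
    -- the uniform error ε does not grow with n.
    Δ-partialSum : ∀ m ε → (∀ t → ∣ u t - sum {m} (λ i → c (toℕ i) * f (toℕ i) t) ∣ ℝ.< ε) →
                   ∀ n t → ∣ Δ n u t - sum {m} (λ i → c (toℕ i) * G n (toℕ i) ⟦ t ⟧) ∣ ℝ.< ε
    Δ-partialSum m ε close zero t = ℝ.<-respˡ-≈
      (∣∣-cong (+-congˡ (-‿cong (sum-cong {m} λ i → *-congˡ (f≈φ (toℕ i) t))))) (close t)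
    Δ-partialSum m ε close (suc n) t = ℝ.<-respˡ-≈ (∣∣-cong eq)
      (∣-∣-< (Δ-partialSum m ε close n (x∙ t))
        (ℝ.≤-<-trans (∣a*b∣≤∣b∣ _ (∣^∣≤1 (q ℕ.^ n) ∣x∣≤1)) (Δ-partialSum m ε close n t)))
      where
      S : Carrier → Carrier
      S z = sum {m} (λ i → c (toℕ i) * G n (toℕ i) z)
      y = x ^ (q ℕ.^ n)
      sum-step : S ⟦ x∙ t ⟧ - y * S ⟦ t ⟧ ≈ sum {m} (λ i → c (toℕ i) * G (suc n) (toℕ i) ⟦ t ⟧)
      sum-step = trans (+-congʳ (sum-cong {m} λ i → *-congˡ (G-cong n (toℕ i) (⟦x∙⟧ t))))
        (trans (sym (sum-difference m y _ _ _)) (sum-cong {m} λ i → *-congˡ (G-difference n (toℕ i) ⟦ t ⟧)))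
      eq : Δ n u (x∙ t) - S ⟦ x∙ t ⟧ - y * (Δ n u t - S ⟦ t ⟧)
             ≈ Δ (suc n) u t - sum {m} (λ i → c (toℕ i) * G (suc n) (toℕ i) ⟦ t ⟧)
      eq = trans (solve 5 (λ a s y b r → a :- s :- y :* (b :- r) := (a :- y :* b) :- (s :- y :* r)) refl _ _ y _ _)
        (+-congˡ (-‿cong sum-step))

    -- By duality every partial sum with more than n terms has n-th difference exactly c_n at 1, so
    -- the discrepancy lies below every ε.
    coefficient : ∀ n → Δ n u (x^ 0) ≈ c n
    coefficient n = a-b≈0⇒a≈b (∣∣<all⇒≈0 close)
      where
      close : ∀ ε → ℝ.0# ℝ.< ε → ∣ Δ n u (x^ 0) - c n ∣ ℝ.< ε
      close ε 0<ε =
        let N , p = uniform ε 0<ε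
            m = N ℕ.⊔ suc n
        in ℝ.<-respˡ-≈ (∣∣-cong (+-congˡ (-‿cong (partialSum≈c m (ℕ.m≤n⊔m N (suc n))))))
             (Δ-partialSum m ε (p m (ℕ.m≤m⊔n N (suc n))) n (x^ 0))
        where
        partialSum≈c : ∀ m → n ℕ.< m → sum {m} (λ i → c (toℕ i) * G n (toℕ i) ⟦ x^ 0 ⟧) ≈ c n
        partialSum≈c m n<m = trans (sum-cong {m} λ i → *-congˡ (G-cong n (toℕ i) τ-1))
          (trans (sum-single m (λ i → c i * G n i 1#) n n<m λ i i≢n → trans (*-congˡ (G-1-off n i i≢n)) (zeroʳ _))
            (trans (*-congˡ (G-1-diagonal n)) (*-identityʳ _)))

    -- Partial sums of 𝔇ᵏu and their size.

    module _ (k : ℕ) where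

      K : ℕ
      K = q ℕ.^ k

      -- The m-th partial sum of 𝔇ᵏu = Σ_i c_{k+i} (f_i(t)/t)^{q^k}.
      s : ℕ → Carrier → Carrier
      s m z = sum {m} (λ i → c (k ℕ.+ toℕ i) * h (toℕ i) z ^ K)

      -- The terms with i < k are annihilated by Δ^k, and each remaining f_i^{q^k} contains the
      -- factor z^{q^k} explicitly. No division takes place, so z = 0 is allowed.
      Δ-shifted : ∀ m z → sum {k ℕ.+ m} (λ i → c (toℕ i) * G k (toℕ i) z) ≈ z ^ K * s m z
      Δ-shifted m z = trans (sum-split k m (λ i → c i * G k i z))
        (trans (+-cong (sum-zero k λ i → trans (*-congˡ (G-below (Fin.toℕ<n i) z)) (zeroʳ _)) refl)
          (trans (+-identityˡ _)
            (trans (sum-cong {m} λ i → trans (*-congˡ (trans (G-diagonal k (toℕ i) z) (^-distrib-* z _ K)))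
                (solve 3 (λ a b c → a :* (b :* c) := b :* (a :* c)) refl _ (z ^ K) _))
              (sym (*-distribˡ-sum {m} (z ^ K) _)))))

      Δ-approximation : ∀ ε → ℝ.0# ℝ.< ε → ∃[ N ] ∀ m → N ℕ.≤ m → ∀ t → ∣ Δ k u t - ⟦ t ⟧ ^ K * s m ⟦ t ⟧ ∣ ℝ.< ε
      Δ-approximation ε 0<ε = let N , p = uniform ε 0<ε in N , λ m N≤m t → ℝ.<-respˡ-≈ (∣∣-cong (+-congˡ (-‿cong (Δ-shifted m ⟦ t ⟧))))
        (Δ-partialSum (k ℕ.+ m) ε (p (k ℕ.+ m) (ℕ.≤-trans N≤m (ℕ.m≤n+m m k))) k t)

      ∣c*h^K∣≤ : ∀ i t → ∣ c (k ℕ.+ i) * h i ⟦ t ⟧ ^ K ∣ ℝ.≤ (q^ (i ℕ.* K)) ℝ.* ∣ c (k ℕ.+ i) ∣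
      ∣c*h^K∣≤ i t = begin
        ∣ c (k ℕ.+ i) * h i ⟦ t ⟧ ^ K ∣                 ≈⟨ ∣∣-* _ _ ⟩
        ∣ c (k ℕ.+ i) ∣ ℝ.* ∣ h i ⟦ t ⟧ ^ K ∣           ≈⟨ ℝ.*-comm _ _ ⟩
        ∣ h i ⟦ t ⟧ ^ K ∣ ℝ.* ∣ c (k ℕ.+ i) ∣           ≈⟨ ℝ.*-congʳ (∣^∣ _ K) ⟩
        ∣ h i ⟦ t ⟧ ∣ ℝ.^ K ℝ.* ∣ c (k ℕ.+ i) ∣         ≤⟨ ℝ.*-monoˡ-≤ (∣∣-nonneg _) (ℝ.^-mono-≤ (∣∣-nonneg _) (∣h∣≤Q^ i (proj₁ t) (proj₂ t)) K) ⟩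
        (Q ℝ.^ i) ℝ.^ K ℝ.* ∣ c (k ℕ.+ i) ∣             ≈⟨ ℝ.*-congʳ (ℝ.^-assocʳ Q i K) ⟩
        (q^ (i ℕ.* K)) ℝ.* ∣ c (k ℕ.+ i) ∣              ∎

      -- The common factor of the partial sums is kept in the bound, so that dividing by it later
      -- bounds 𝔇ᵏu.
      ∣Δ∣≤ : ∀ {S} → ℝ.0# ℝ.≤ S → (∀ i → (q^ (i ℕ.* K)) ℝ.* ∣ c (k ℕ.+ i) ∣ ℝ.≤ S) →
             ∀ t → ∣ Δ k u t ∣ ℝ.≤ ∣ ⟦ t ⟧ ^ K ∣ ℝ.* S
      ∣Δ∣≤ {S} 0≤S bounded t = ∣∣-limit-≤ (ℝ.*-nonneg (∣∣-nonneg _) 0≤S) λ ε 0<ε →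
        let N , p = Δ-approximation ε 0<ε in
        _ , p N ℕ.≤-refl t , ∣*∣-≤ ℝ.≤-refl (∣sum∣≤ 0≤S {N} _ λ i → ℝ.≤-trans (∣c*h^K∣≤ (toℕ i) t) (bounded (toℕ i)))

      -- From a continuous extension to the decay of the coefficients and the norm formula.

      module _ {g : O → Carrier} (extension : IsContinuousExtensionOf𝔇 k u g) where
        open IsContinuousExtensionOf𝔇 extension

        ⟦⟧^K*g≈Δ : ∀ t → Nonzero t → ⟦ t ⟧ ^ K * g t ≈ Δ k u t
        ⟦⟧^K*g≈Δ t t≉0 = trans (*-congˡ (extends t t≉0)) (⁻¹-cancelʳ (^-nonzero (ι-nonzero t≉0) K) _)

        private
          ∣g∣≤-nonzero : ∀ {S} → ℝ.0# ℝ.≤ S → (∀ i → (q^ (i ℕ.* K)) ℝ.* ∣ c (k ℕ.+ i) ∣ ℝ.≤ S) →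
                         ∀ t → Nonzero t → ∣ g t ∣ ℝ.≤ S
          ∣g∣≤-nonzero 0≤S bounded t t≉0 = ℝ.*-cancelʳ-≤ (∣∣-pos (^-nonzero (ι-nonzero t≉0) K))
            (ℝ.≤-respˡ (ℝ.trans (∣∣-cong (sym (⟦⟧^K*g≈Δ t t≉0))) (∣∣-* _ _)) (∣Δ∣≤ 0≤S bounded t))

          -- At 0 the formula for 𝔇ᵏu gives no information; the bound is carried there by continuity
          -- along the powers of x.
          ∣g∣≤-zero : ∀ {S} → ℝ.0# ℝ.≤ S → (∀ i → (q^ (i ℕ.* K)) ℝ.* ∣ c (k ℕ.+ i) ∣ ℝ.≤ S) →
                      ∀ t → ⟦ t ⟧ ≈ 0# → ∣ g t ∣ ℝ.≤ S
          ∣g∣≤-zero 0≤S bounded t t≈0 = ∣∣-limit-≤ 0≤S λ ε 0<ε →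
            let N , p = x^→zero continuous t t≈0 ε 0<ε in
            g (x^ N) , ℝ.<-respˡ-≈ (∣a-b∣≈∣b-a∣ _ _) (p N ℕ.≤-refl) , ∣g∣≤-nonzero 0≤S bounded (x^ N) (x^-nonzero N)

        ∣g∣≤ : ∀ {S} → ℝ.0# ℝ.≤ S → (∀ i → (q^ (i ℕ.* K)) ℝ.* ∣ c (k ℕ.+ i) ∣ ℝ.≤ S) → ∀ t → ∣ g t ∣ ℝ.≤ S
        ∣g∣≤ 0≤S bounded t = [ ∣g∣≤-zero 0≤S bounded t , (λ t≉0 → ∣g∣≤-nonzero 0≤S bounded t (t≉0 ∘ ι-zero)) ]′
          (toSum (⟦ t ⟧ ≈0?))

        -- Passing from row n to row n + 1, Δ multiplies by x^{q^{n+k}} while the normalizing power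
        -- of x gains the exponent q^k; the quotient remains. Truncated subtraction is exact here,
        -- since q^k ≤ q^{n+k}.
        y : ℕ → Carrier
        y n = x ^ (q ℕ.^ (n ℕ.+ k) ∸ K)

        ∣y∣≤1 : ∀ n → ∣ y n ∣ ℝ.≤ ℝ.1#
        ∣y∣≤1 n = ∣^∣≤1 (q ℕ.^ (n ℕ.+ k) ∸ K) ∣x∣≤1

        open DifferenceScheme ℝ F C using (∣W∣≤∣W₀∣; ∣W∣→0)

        -- W n j = Δ^{n+k}u(x^j) / x^{(n+j)q^k}.
        W : ℕ → ℕ → Carrier
        W = DifferenceScheme.W ℝ F C (g ∘ x^) y ∣y∣≤1

        private
          instance
            q-nonZero : ℕ.NonZero q
            q-nonZero = ℕ.>-nonZero 1≤q

        Δ≈x^*W : ∀ n j → Δ (n ℕ.+ k) u (x^ j) ≈ x ^ ((n ℕ.+ j) ℕ.* K) * W n j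
        Δ≈x^*W zero    j = trans (sym (⟦⟧^K*g≈Δ (x^ j) (x^-nonzero j)))
          (*-congʳ (trans (^-congˡ K (⟦x^⟧ j)) (^-assocʳ x j K)))
        Δ≈x^*W (suc n) j = trans
          (+-cong (trans (Δ≈x^*W n (suc j)) (*-congʳ (trans (^-congʳ x (≡.cong (ℕ._* K) (ℕ.+-suc n j))) (^-homo-* x K _))))
                  (-‿cong (*-cong (trans (^-congʳ x (≡.sym (ℕ.m+[n∸m]≡n (ℕ.^-monoʳ-≤ q (ℕ.m≤n+m k n))))) (^-homo-* x K _)) (Δ≈x^*W n j))))
          (trans (solve 5 (λ a b w y w′ → (a :* b) :* w :- (a :* y) :* (b :* w′) := (a :* b) :* (w :- y :* w′)) refl (x ^ K) (x ^ ((n ℕ.+ j) ℕ.* K)) _ _ _)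
            (*-congʳ (sym (^-homo-* x K ((n ℕ.+ j) ℕ.* K)))))

        ∣W∣≈ : ∀ n → ∣ W n 0 ∣ ℝ.≈ (q^ (n ℕ.* K)) ℝ.* ∣ c (n ℕ.+ k) ∣
        ∣W∣≈ n = ℝ.sym (begin-equality
          (q^ (n ℕ.* K)) ℝ.* ∣ c (n ℕ.+ k) ∣                       ≈⟨ ℝ.*-congˡ (∣∣-cong (coefficient (n ℕ.+ k))) ⟨
          (q^ (n ℕ.* K)) ℝ.* ∣ Δ (n ℕ.+ k) u (x^ 0) ∣              ≈⟨ ℝ.*-congˡ (ℝ.trans (∣∣-cong (Δ≈x^*W n 0)) (∣∣-* _ _)) ⟩
          (q^ (n ℕ.* K)) ℝ.* (∣ x ^ ((n ℕ.+ 0) ℕ.* K) ∣ ℝ.* ∣ W n 0 ∣)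
            ≈⟨ ℝ.*-congˡ (ℝ.*-congʳ (∣∣-cong (^-congʳ x (≡.cong (ℕ._* K) (ℕ.+-identityʳ n))))) ⟩
          (q^ (n ℕ.* K)) ℝ.* (∣ x ^ (n ℕ.* K) ∣ ℝ.* ∣ W n 0 ∣)     ≈⟨ ℝ.*-assoc _ _ _ ⟨
          (q^ (n ℕ.* K)) ℝ.* ∣ x ^ (n ℕ.* K) ∣ ℝ.* ∣ W n 0 ∣       ≈⟨ ℝ.*-congʳ (Q^*∣x^∣≈1 (n ℕ.* K)) ⟩
          ℝ.1# ℝ.* ∣ W n 0 ∣                                       ≈⟨ ℝ.*-identityˡ _ ⟩
          ∣ W n 0 ∣                                                ∎)


        Q*∣y*a∣≤∣a∣ : ∀ n a → Q ℝ.* ∣ y (suc n) * a ∣ ℝ.≤ ∣ a ∣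
        Q*∣y*a∣≤∣a∣ n a = begin
          Q ℝ.* ∣ x ^ e * a ∣            ≈⟨ ℝ.*-congˡ (ℝ.trans (∣∣-* _ _) (ℝ.*-congʳ (∣^∣ x e))) ⟩
          Q ℝ.* (∣ x ∣ ℝ.^ e ℝ.* ∣ a ∣)  ≤⟨ ℝ.*-monoʳ-≤ (ℝ.<⇒≤ 0<Q) (ℝ.*-monoˡ-≤ (∣∣-nonneg a)
                                             (ℝ.^-≤ (∣∣-nonneg x) ∣x∣≤1 e (ℕ.m<n⇒0<n∸m (ℕ.^-monoʳ-< q F.2≤q (s≤s (ℕ.m≤n+m k n)))))) ⟩
          Q ℝ.* (∣ x ∣ ℝ.* ∣ a ∣)        ≈⟨ ℝ.*-congˡ (∣∣-* x a) ⟨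
          Q ℝ.* ∣ x * a ∣                ≈⟨ Q*∣x*a∣≈∣a∣ a ⟩
          ∣ a ∣                          ∎
          where e = q ℕ.^ (suc n ℕ.+ k) ∸ K

        -- W 1 j = g(x^{j+1}) − g(x^j).
        W₁→0 : ∀ ε → ℝ.0# ℝ.< ε → ∃[ N ] ∀ j → N ℕ.≤ j → ∣ W 1 j ∣ ℝ.< ε
        W₁→0 ε 0<ε =
          let N , p = x^→zero continuous (0ᴸ , ∣const∣≤1 F.0#) τ-0 ε 0<ε
          in N , λ j N≤j → ℝ.<-respˡ-≈ (∣∣-cong (+-congˡ (-‿cong (sym
               (trans (*-congʳ (^-congʳ x (ℕ.n∸n≡0 K))) (*-identityˡ _))))))
             (∣-∣-trans-< (p (suc j) (ℕ.m≤n⇒m≤1+n N≤j)) (ℝ.<-respˡ-≈ (∣a-b∣≈∣b-a∣ _ _) (p j N≤j)))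

        W→0 : ∀ ε → ℝ.0# ℝ.< ε → ∃[ N ] ∀ n → N ℕ.≤ n → ∣ W n 0 ∣ ℝ.< ε
        W→0 = ∣W∣→0 (g ∘ x^) y ∣y∣≤1 Q*∣y*a∣≤∣a∣ W₁→0

        ∣W∸∣≈ : ∀ n → k ℕ.≤ n → ∣ W (n ∸ k) 0 ∣ ℝ.≈ (q^ ((n ∸ k) ℕ.* K)) ℝ.* ∣ c n ∣
        ∣W∸∣≈ n k≤n = ℝ.trans (∣W∣≈ (n ∸ k)) (ℝ.*-congˡ (ℝ.reflexive (≡.cong (λ m → ∣ c m ∣) (ℕ.m∸n+n≡m k≤n))))

        weighted : ℕ → ℝ.Carrier
        weighted n = (q^ (n ℕ.* K)) ℝ.* ∣ c n ∣

        -- The decay condition weights c_n by n, whereas W and the norm formula weight it by n - k.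
        -- The two differ by a constant factor, which does not affect convergence to 0.
        weighted≈ : ∀ n → k ℕ.≤ n → weighted n ℝ.≈ (q^ (k ℕ.* K)) ℝ.* ∣ W (n ∸ k) 0 ∣
        weighted≈ n k≤n = begin-equality
          (q^ (n ℕ.* K)) ℝ.* ∣ c n ∣
            ≈⟨ ℝ.*-congʳ (ℝ.^-congʳ Q (≡.trans (≡.cong (ℕ._* K) (≡.sym (ℕ.m+[n∸m]≡n k≤n))) (ℕ.*-distribʳ-+ K k (n ∸ k)))) ⟩
          (q^ (k ℕ.* K ℕ.+ (n ∸ k) ℕ.* K)) ℝ.* ∣ c n ∣              ≈⟨ ℝ.*-congʳ (ℝ.^-homo-* Q (k ℕ.* K) ((n ∸ k) ℕ.* K)) ⟩
          (q^ (k ℕ.* K)) ℝ.* (q^ ((n ∸ k) ℕ.* K)) ℝ.* ∣ c n ∣        ≈⟨ ℝ.*-assoc _ _ _ ⟩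
          (q^ (k ℕ.* K)) ℝ.* ((q^ ((n ∸ k) ℕ.* K)) ℝ.* ∣ c n ∣)      ≈⟨ ℝ.*-congˡ (∣W∸∣≈ n k≤n) ⟨
          (q^ (k ℕ.* K)) ℝ.* ∣ W (n ∸ k) 0 ∣                        ∎

        weighted→0 : ℝ.TendsToZero weighted
        weighted→0 = ℝ.tendsToZero (λ n → ℝ.*-nonneg (ℝ.^-nonneg (ℝ.<⇒≤ 0<Q) (n ℕ.* K)) (∣∣-nonneg _)) λ ε 0<ε →
          let P = q^ (k ℕ.* K)
              0<P = ℝ.^-pos 0<Q (k ℕ.* K)
              N , p = W→0 (P ℝ.⁻¹ ℝ.* ε) (ℝ.*-pos (ℝ.⁻¹-pos 0<P) 0<ε)
          in k ℕ.+ N , λ n k+N≤n →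
               ℝ.<-respˡ-≈ (ℝ.sym (weighted≈ n (ℕ.≤-trans (ℕ.m≤m+n k N) k+N≤n)))
                 (ℝ.<-respʳ-≈ (ℝ.⁻¹-cancelʳ (ℝ.0<⇒≉0 0<P) ε)
                   (ℝ.*-monoʳ-< 0<P (p (n ∸ k) (≡.subst (ℕ._≤ n ∸ k) (ℕ.m+n∸m≡n k N) (ℕ.∸-monoˡ-≤ k k+N≤n)))))

        shifted : Σ[ n ∈ ℕ ] k ℕ.≤ n → ℝ.Carrier
        shifted (n , _) = (q^ ((n ∸ k) ℕ.* K)) ℝ.* ∣ c n ∣

        shifted-bounded : ∃[ M ] ℝ.IsUpperBound shifted M
        shifted-bounded =
          let N , small = W→0 ℝ.1# ℝ.0<1
              M , _ , bounded = ℝ.eventuallyBounded⇒bounded (λ n → ∣ W n 0 ∣) N ℝ.1# (λ n N≤n → ℝ.<⇒≤ (small n N≤n))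
          in M , λ (n , k≤n) → ℝ.≤-respˡ (∣W∸∣≈ n k≤n) (bounded (n ∸ k))

        -- Completeness is applied to the weighted coefficients. Their supremum bounds g through the
        -- series, and any weighted coefficient above b is some |W (n - k) 0|, hence dominated by
        -- |g(x^j)| for one j.
        suprema-agree : ∃[ S ] ℝ.IsSup (λ t → ∣ g t ∣) S × ℝ.IsSup shifted S
        suprema-agree =
          let S , upper , approached = ℝ.complete shifted (k , ℕ.≤-refl) shifted-bounded
              nonneg : ℝ.0# ℝ.≤ S
              nonneg = ℝ.≤-trans (ℝ.*-nonneg (ℝ.^-nonneg (ℝ.<⇒≤ 0<Q) ((k ∸ k) ℕ.* K)) (∣∣-nonneg _)) (upper (k , ℕ.≤-refl))
              bounded : ∀ i → (q^ (i ℕ.* K)) ℝ.* ∣ c (k ℕ.+ i) ∣ ℝ.≤ S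
              bounded i = ℝ.≤-respˡ (ℝ.*-congʳ (ℝ.^-congʳ Q (≡.cong (ℕ._* K) (ℕ.m+n∸m≡n k i)))) (upper (k ℕ.+ i , ℕ.m≤m+n k i))
          in S , (∣g∣≤ nonneg bounded , λ b b<S →
                   let (n , k≤n) , b<shifted = approached b b<S
                       j , p = ∣W∣≤∣W₀∣ (g ∘ x^) y ∣y∣≤1 (n ∸ k) 0
                   in x^ j , ℝ.<-≤-trans b<shifted (ℝ.≤-respˡ (∣W∸∣≈ n k≤n) p))
               , (upper , approached)

      -- From the decay of the coefficients to a continuous extension.

      module _ (weights→0 : ℝ.TendsToZero (λ n → (q^ (n ℕ.* K)) ℝ.* ∣ c n ∣)) where

        s-tail : ∀ ε → ℝ.0# ℝ.< ε → ∃[ N ] ∀ m → N ℕ.≤ m → ∀ t → ∣ s m ⟦ t ⟧ - s N ⟦ t ⟧ ∣ ℝ.< ε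
        s-tail ε 0<ε =
          let N , p = weights→0 ε 0<ε
          in N , λ m N≤m t →
            let a = λ i → c (k ℕ.+ i) * h i ⟦ t ⟧ ^ K
            in ℝ.<-respˡ-≈ (∣∣-cong (trans (solve 2 (λ u v → v := (u :+ v) :- u) refl (s N ⟦ t ⟧) _)
                 (+-congʳ (trans (sym (sum-split N (m ∸ N) a)) (reflexive (≡.cong (λ l → s l ⟦ t ⟧) (ℕ.m+[n∸m]≡n N≤m)))))))
               (∣sum∣< 0<ε (m ∸ N) (λ i → a (N ℕ.+ toℕ i)) (λ i → begin-strict
                 ∣ a (N ℕ.+ toℕ i) ∣                                                         ≤⟨ ∣c*h^K∣≤ (N ℕ.+ toℕ i) t ⟩
                 (q^ ((N ℕ.+ toℕ i) ℕ.* K)) ℝ.* ∣ c (k ℕ.+ (N ℕ.+ toℕ i)) ∣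
                   -- The term with index i in the series belongs to c_{k+i}, and the hypothesis
                   -- weights it by (k + i) q^k, which is at least the required i q^k.
                   ≤⟨ ℝ.*-monoˡ-≤ (∣∣-nonneg _) (ℝ.^-monoʳ-≤ (ℝ.<⇒≤ 1<Q) (ℕ.*-monoˡ-≤ K (ℕ.m≤n+m (N ℕ.+ toℕ i) k))) ⟩
                 (q^ ((k ℕ.+ (N ℕ.+ toℕ i)) ℕ.* K)) ℝ.* ∣ c (k ℕ.+ (N ℕ.+ toℕ i)) ∣
                   <⟨ proj₂ (p (k ℕ.+ (N ℕ.+ toℕ i)) (ℕ.≤-trans (ℕ.m≤m+n N (toℕ i)) (ℕ.m≤n+m _ k))) ⟩
                 ε                                                                           ∎))

        s-cauchy : ∀ ε → ℝ.0# ℝ.< ε → ∃[ N ] ∀ m n → N ℕ.≤ m → N ℕ.≤ n → ∀ t → ∣ s m ⟦ t ⟧ - s n ⟦ t ⟧ ∣ ℝ.< ε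
        s-cauchy ε 0<ε =
          let N , p = s-tail ε 0<ε
          in N , λ m n N≤m N≤n t → ∣-∣-trans-< (p m N≤m t) (ℝ.<-respˡ-≈ (∣a-b∣≈∣b-a∣ _ _) (p n N≤n t))

        limit : ∀ t → ∃[ l ] ℝ.TendsToZero (λ n → ∣ s n ⟦ t ⟧ - l ∣)
        limit t = complete (λ n → s n ⟦ t ⟧) λ ε 0<ε →
          let N , p = s-cauchy ε 0<ε in N , λ m n N≤m N≤n → p m n N≤m N≤n t

        -- The threshold N depends on ε alone. The auxiliary index n may vary with t, but it drops
        -- out by the ultrametric inequality.
        s-uniform : ∀ ε → ℝ.0# ℝ.< ε → ∃[ N ] ∀ m → N ℕ.≤ m → ∀ t → ∣ s m ⟦ t ⟧ - proj₁ (limit t) ∣ ℝ.< ε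
        s-uniform ε 0<ε =
          let N , p = s-cauchy ε 0<ε
          in N , λ m N≤m t →
            let N′ , p′ = proj₂ (limit t) ε 0<ε
                n = m ℕ.⊔ N′
            in ∣-∣-trans-< (p m n N≤m (ℕ.≤-trans N≤m (ℕ.m≤m⊔n m N′)) t) (proj₂ (p′ n (ℕ.m≤n⊔m m N′)))

        Lipschitz-s : ∀ m → Lipschitz (s m)
        Lipschitz-s m = Lipschitz-sum m (λ i → Lipschitz-* (Lipschitz-const (c (k ℕ.+ toℕ i))) (Lipschitz-^ (Lipschitz-h (toℕ i)) K))

        limit-continuous : Continuous (proj₁ ∘ limit)
        limit-continuous t₀ ε 0<ε =
          let N , p = s-uniform ε 0<ε
              δ , 0<δ , near = Lipschitz⇒Continuous (Lipschitz-s N) t₀ ε 0<ε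
          in δ , 0<δ , λ t t-near → ∣-∣-trans-< (ℝ.<-respˡ-≈ (∣a-b∣≈∣b-a∣ _ _) (p N ℕ.≤-refl t))
               (∣-∣-trans-< (near t t-near) (p N ℕ.≤-refl t₀))

        -- Both sides are limits of the same t^{q^k} s_m(t), as |t^{q^k}| ≤ 1 preserves the
        -- approximation of the limit. In this multiplied form the identity holds at 0 as well.
        ⟦⟧^K*limit≈Δ : ∀ t → ⟦ t ⟧ ^ K * proj₁ (limit t) ≈ Δ k u t
        ⟦⟧^K*limit≈Δ t = a-b≈0⇒a≈b (∣∣<all⇒≈0 λ ε 0<ε →
          let N , p = s-uniform ε 0<ε
              N′ , p′ = Δ-approximation ε 0<ε
              m = N ℕ.⊔ N′
          in compare (s m ⟦ t ⟧) (p m (ℕ.m≤m⊔n N N′) t) (p′ m (ℕ.m≤n⊔m N N′) t))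
          where
          compare : ∀ {ε} a → ∣ a - proj₁ (limit t) ∣ ℝ.< ε → ∣ Δ k u t - ⟦ t ⟧ ^ K * a ∣ ℝ.< ε →
                    ∣ ⟦ t ⟧ ^ K * proj₁ (limit t) - Δ k u t ∣ ℝ.< ε
          compare a a-near Δ-near = ∣y*l-d∣<ε (∣^∣≤1 K (proj₂ t)) a-near Δ-near

        limit-extends : IsContinuousExtensionOf𝔇 k u (proj₁ ∘ limit)
        limit-extends = record
          { continuous = limit-continuous
          ; extends = λ t t≉0 → trans (sym (⁻¹-cancelˡ (^-nonzero (ι-nonzero t≉0) K) _)) (*-congˡ (⟦⟧^K*limit≈Δ t))
          }

theorem2 :
  (p γ : ℕ) → Prime p → 1 ℕ.≤ γ →
  (ℝ : CompleteOrderedField) (F : FiniteField (p ℕ.^ γ)) (C : CompletedAlgebraicClosure ℝ F) →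
  let module ℝ = CompleteOrderedField ℝ
      module C = CompletedAlgebraicClosure C
      open C using (∣_∣)
      open Carlitz ℝ F C
      q = p ℕ.^ γ
  in
  (k : ℕ) (u : O → C.Carrier) (c : ℕ → C.Carrier) →
  C₀ u → IsCarlitzExpansion u c →
  (C₀^[1+ k ] u ⇔ ℝ.TendsToZero (λ n → (q^ (n ℕ.* q ℕ.^ k)) ℝ.* ∣ c n ∣))
  ×
  (∀ 𝔇ᵏu → IsContinuousExtensionOf𝔇 k u 𝔇ᵏu →
    ∃[ s ] ℝ.IsSup (λ t → ∣ 𝔇ᵏu t ∣) s
         × ℝ.IsSup (λ ((n , _) : Σ[ n ∈ ℕ ] k ℕ.≤ n) → (q^ ((n ∸ k) ℕ.* q ℕ.^ k)) ℝ.* ∣ c n ∣) s)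
theorem2 p γ _ _ ℝ F C k u c u∈C₀ expansion =
  mk⇔ (λ (_ , _ , extension) → weighted→0 k extension) (λ weights→0 → u∈C₀ , _ , limit-extends k weights→0) ,
  λ _ extension → suprema-agree k extension
  where open Expansion.Coefficients ℝ F C u c expansion
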